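{- Let $n\ge2$ and $u,v\in A_n^*$. Then $u\ \ddot{\sim}\ v$ if and only if $u\sim_{\mathrm{hypo}_n}v$. Therefore the hypoplactic monoid $\mathrm{hypo}(\mathcal{A}_n)=A_n^*/\ddot{\sim}$ and the classical hypoplactic monoid $\mathrm{hypo}_n=A_n^*/\sim_{\mathrm{hypo}_n}$ are isomorphic monoids.
   Context: Let $A_n=\{1<2<\cdots<n\}$ and $A_n^*$ the free monoid of words over it; $|w|_a$ denotes the number of occurrences of the letter $a$ in $w$. The classical hypoplactic congruence $\sim_{\mathrm{hypo}_n}$ is the monoid congruence on $A_n^*$ generated by the pairs $(yzx,yxz)$ and $(xzy,zxy)$ for $x<y<z$; $(xyx,xxy)$ and $(xyy,yxy)$ for $x<y$; $(xzty,zxyt)$ for $t\le x<y\le z$; and $(ytzx,tyxz)$ for $t<x\le y<z$ (all letters in $A_n$). Quasi-crystal structure on $A_n^*$ (the free quasi-crystal monoid over the standard quasi-crystal of type $\mathfrak{A}_n$, with index set $\{1,\dots,n-1\}$): $\mathrm{wt}(w)=(|w|_1,\dots,|w|_n)\in\mathbb{Z}^n$. For $i\in\{1,\dots,n-1\}$, $w$ has an $i$-inversion if $w=w_1\,i\,w_2\,(i+1)\,w_3$ for some words $w_1,w_2,w_3$. If $w$ has an $i$-inversion then $\ddot{\varepsilon}_i(w)=\ddot{\varphi}_i(w)=+\infty$ and $\ddot{e}_i(w),\ddot{f}_i(w)$ are undefined; otherwise $\ddot{\varepsilon}_i(w)=|w|_{i+1}$, $\ddot{\varphi}_i(w)=|w|_i$,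 $\ddot{e}_i(w)$ is defined iff $|w|_{i+1}>0$ and is obtained by replacing the right-most $i+1$ in $w$ by $i$, and $\ddot{f}_i(w)$ is defined iff $|w|_i>0$ and is obtained by replacing the left-most $i$ in $w$ by $i+1$. The connected component $A_n^*(w)$ of $w$ is the set of words obtained from $w$ by finitely many (defined) applications of the operators $\ddot{e}_i,\ddot{f}_i$. The hypoplactic congruence $\ddot{\sim}$: $u\ddot{\sim}v$ iff there is a bijection $\psi:A_n^*(u)\to A_n^*(v)$ with $\psi(u)=v$ such that for all $x\in A_n^*(u)$ and $i$: $\mathrm{wt}(\psi(x))=\mathrm{wt}(x)$, $\ddot{\varepsilon}_i(\psi(x))=\ddot{\varepsilon}_i(x)$, $\ddot{\varphi}_i(\psi(x))=\ddot{\varphi}_i(x)$, $\ddot{e}_i(\psi(x))$ is defined iff $\ddot{e}_i(x)$ is (and then $\psi(\ddot{e}_i(x))=\ddot{e}_i(\psi(x))$), and likewise for $\ddot{f}_i$. It is a monoid congruence on $A_n^*$. -}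

module Defs where

open import Data.Nat using (ℕ; zero; suc)
open import Data.Fin using (Fin; inject₁; _<_; _≤_) renaming (suc to fsuc)
open import Data.Fin.Properties using (_≟_)
open import Data.List using (List; []; _∷_; _++_)
open import Data.Maybe using (Maybe; just; nothing)
import Data.Maybe as Maybe
open import Data.Bool using (Bool; true; false; if_then_else_; _∨_)
open import Data.Product using (Σ; ∃; _×_; _,_)
open import Data.Sum using (_⊎_)
open import Relation.Nullary using (yes; no; does)
open import Relation.Binary.PropositionalEquality using (_≡_)
open import Relation.Binary.Construct.Closure.ReflexiveTransitive using (Star)

-- Convention: n = suc m.  The alphabet A_n = {1 < ... < n} is Fin (suc m)
-- (letter k+1 is represented by the Fin element k, with the usual order).
-- The index set {1,...,n-1} is Fin m: index i corresponds to the letters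
-- "i" = inject₁ i and "i+1" = fsuc i.

Letter : ℕ → Set
Letter m = Fin (suc m)

Word : ℕ → Set
Word m = List (Letter m)

module _ {m : ℕ} where

  data HypoGen : Word m → Word m → Set where
    knuth₁ : ∀ {x y z} → x < y → y < z →
             HypoGen (y ∷ z ∷ x ∷ []) (y ∷ x ∷ z ∷ [])
    knuth₂ : ∀ {x y z} → x < y → y < z →
             HypoGen (x ∷ z ∷ y ∷ []) (z ∷ x ∷ y ∷ [])
    knuth₃ : ∀ {x y} → x < y →
             HypoGen (x ∷ y ∷ x ∷ []) (x ∷ x ∷ y ∷ [])
    knuth₄ : ∀ {x y} → x < y →
             HypoGen (x ∷ y ∷ y ∷ []) (y ∷ x ∷ y ∷ [])
    quartic₁ : ∀ {t x y z} → t ≤ x → x < y → y ≤ z →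
             HypoGen (x ∷ z ∷ t ∷ y ∷ []) (z ∷ x ∷ y ∷ t ∷ [])
    quartic₂ : ∀ {t x y z} → t < x → x ≤ y → y < z →
             HypoGen (y ∷ t ∷ z ∷ x ∷ []) (t ∷ y ∷ x ∷ z ∷ [])

  data _∼hypo_ : Word m → Word m → Set where
    gen   : ∀ {u v} → HypoGen u v → u ∼hypo v
    ctx   : ∀ {u v} (p q : Word m) → u ∼hypo v → (p ++ u ++ q) ∼hypo (p ++ v ++ q)
    refl′ : ∀ {u} → u ∼hypo u
    sym′  : ∀ {u v} → u ∼hypo v → v ∼hypo u
    trans′ : ∀ {u v w} → u ∼hypo v → v ∼hypo w → u ∼hypo w

data ℕ∞ : Set where
  fin : ℕ → ℕ∞
  ∞   : ℕ∞

module _ {m : ℕ} where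

  count : Letter m → Word m → ℕ
  count a [] = 0
  count a (b ∷ w) with does (a ≟ b)
  ... | true  = suc (count a w)
  ... | false = count a w

  occurs : Letter m → Word m → Bool
  occurs a [] = false
  occurs a (b ∷ w) = does (a ≟ b) ∨ occurs a w

  hasInv : Fin m → Word m → Bool
  hasInv i [] = false
  hasInv i (b ∷ w) with does (inject₁ i ≟ b)
  ... | true  = occurs (fsuc i) w ∨ hasInv i w
  ... | false = hasInv i w

  replaceLeft : Letter m → Letter m → Word m → Maybe (Word m)
  replaceLeft a b [] = nothing
  replaceLeft a b (c ∷ w) with does (a ≟ c)
  ... | true  = just (b ∷ w)
  ... | false = Maybe.map (c ∷_) (replaceLeft a b w)

  replaceRight : Letter m → Letter m → Word m → Maybe (Word m)
  replaceRight a b [] = nothing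
  replaceRight a b (c ∷ w) with replaceRight a b w
  ... | just w′ = just (c ∷ w′)
  ... | nothing with does (a ≟ c)
  ...   | true  = just (b ∷ w)
  ...   | false = nothing

  ε̈ : Fin m → Word m → ℕ∞
  ε̈ i w = if hasInv i w then ∞ else fin (count (fsuc i) w)

  φ̈ : Fin m → Word m → ℕ∞
  φ̈ i w = if hasInv i w then ∞ else fin (count (inject₁ i) w)

  ë : Fin m → Word m → Maybe (Word m)
  ë i w = if hasInv i w then nothing else replaceRight (fsuc i) (inject₁ i) w

  f̈ : Fin m → Word m → Maybe (Word m)
  f̈ i w = if hasInv i w then nothing else replaceLeft (inject₁ i) (fsuc i) w

  Step : Word m → Word m → Set
  Step w x = ∃ λ i → (ë i w ≡ just x) ⊎ (f̈ i w ≡ just x)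

  InComp : Word m → Word m → Set
  InComp w x = Star Step w x

  -- u ̈∼ v : a bijection ψ : A_n^*(u) → A_n^*(v) with ψ u = v preserving
  -- weight, ε̈, φ̈, and commuting with ë, f̈ (including definedness).
  -- ψ is given as a function on words whose restriction to A_n^*(u) is
  -- a bijection onto A_n^*(v).
  record IsQCIso (u v : Word m) (ψ : Word m → Word m) : Set where
    field
      maps-to   : ∀ x → InComp u x → InComp v (ψ x)
      injective : ∀ x y → InComp u x → InComp u y → ψ x ≡ ψ y → x ≡ y
      surjective : ∀ y → InComp v y → ∃ λ x → InComp u x × ψ x ≡ y
      base      : ψ u ≡ v
      wt-pres   : ∀ x → InComp u x → ∀ a → count a (ψ x) ≡ count a x
      ε-pres    : ∀ x → InComp u x → ∀ i → ε̈ i (ψ x) ≡ ε̈ i x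
      φ-pres    : ∀ x → InComp u x → ∀ i → φ̈ i (ψ x) ≡ φ̈ i x
      e-comm    : ∀ x → InComp u x → ∀ i → ë i (ψ x) ≡ Maybe.map ψ (ë i x)
      f-comm    : ∀ x → InComp u x → ∀ i → f̈ i (ψ x) ≡ Maybe.map ψ (f̈ i x)

  _∼̈_ : Word m → Word m → Set
  u ∼̈ v = ∃ λ ψ → IsQCIso u v ψ

{-# OPTIONS --safe #-}
-- Say that a < b are consecutive in w if both occur, no letter strictly between them occurs, and
-- some a precedes some b.  The content of w together with its set of consecutive pairs is a
-- complete invariant for both relations.
--
-- For ∼hypo: if (a , b) is consecutive in w, then w is congruent to its subword of letters ≤ a
-- followed by its subword of letters ≥ b, and induction on the length applies to both factors;
-- a word without consecutive pairs is weakly decreasing, hence determined by its content.  The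
-- congruence rests on the fact that t L K ∼ t K L for words L ≤ t < K, and dually L K b ∼ K L b
-- for L < b ≤ K.
--
-- For ∼̈: if no letter strictly between a and b occurs, then a can be raised letter by letter with
-- the operators f̈ until it becomes b - 1, where ε̈ tells whether a precedes b.  Conversely, each
-- defining relation of ∼hypo is a composite of exchanges of two adjacent letters x < z, and the
-- exchange of the same two positions commutes with all operators on the whole component, because
-- ë and f̈ do not change the standardization of a word.

module Submission where

open import Defs
open import Data.Nat as ℕ using (ℕ; zero; suc; _+_; s≤s)
import Data.Nat.Properties as ℕ
open import Data.Nat.Tactic.RingSolver using (solve-∀)
open import Data.Fin using (Fin; toℕ; inject₁; _<_; _≤_; fromℕ<; opposite) renaming (suc to fsuc)
open import Data.Fin.Properties as Fin
  using (_≟_; _<?_; _≤?_; opposite-prop; opposite-involutive; toℕ<n; toℕ-injective; toℕ-inject₁; toℕ-fromℕ<)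
open import Level using (0ℓ)
open import Data.Bool using (true; false; _∨_)
open import Data.Bool.Properties using (∨-zeroʳ; ¬-not)
open import Data.Maybe using (Maybe; just; nothing)
import Data.Maybe as Maybe
import Data.Maybe.Properties as Maybe
open import Data.Maybe.Properties using (just-injective)
open import Data.List using ([]; _∷_; _++_; [_]; _∷ʳ_; length; map; filter; reverse; initLast; _∷ʳ′_)
open import Data.List.Properties
open import Data.List.Membership.Propositional using (_∈_; lose)
open import Data.List.Membership.Propositional.Properties
  using (∈-++⁺ʳ; ∈-filter⁺; ∈-filter⁻)
open import Data.List.Relation.Unary.Any using (Any; here; there)
import Data.List.Relation.Unary.Any.Properties as Any
open import Data.List.Relation.Unary.All as All using (All; []; _∷_)
import Data.List.Relation.Unary.All.Properties as All
open import Data.List.Relation.Unary.AllPairs using (AllPairs; []; _∷_)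
import Data.List.Relation.Binary.Permutation.Propositional as Perm
import Data.List.Relation.Binary.Permutation.Propositional.Properties as Perm
open import Data.List.Relation.Binary.Pointwise as Pointwise using (Pointwise; []; _∷_)
open import Data.Product using (∃; ∃₂; _×_; _,_; proj₁; proj₂)
open import Data.Sum using (_⊎_; inj₁; inj₂)
open import Function using (_∘_)
open import Function.Bundles using (_⇔_; mk⇔)
open import Relation.Nullary using (¬_; yes; no; contradiction)
open import Relation.Nullary.Decidable using (dec-true; dec-false)
open import Relation.Unary using (Pred; Decidable)
open import Relation.Binary.Bundles using (Setoid)
open import Relation.Binary.Construct.Closure.ReflexiveTransitive using (ε; _◅_; _◅◅_)
open import Relation.Binary.PropositionalEquality
  using (_≡_; refl; sym; trans; cong; cong₂; subst; subst₂; module ≡-Reasoning)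
import Relation.Binary.Reasoning.Setoid as SetoidReasoning

-- The congruence `∼hypo`: first consequences and the duality `δ`.

module _ {m : ℕ} where

  hypo-setoid : Setoid _ _
  hypo-setoid = record
    { Carrier = Word m ; _≈_ = _∼hypo_
    ; isEquivalence = record { refl = refl′ ; sym = sym′ ; trans = trans′ } }

  ++-congʳ : ∀ p {u v : Word m} → u ∼hypo v → (p ++ u) ∼hypo (p ++ v)
  ++-congʳ p {u} {v} r =
    subst₂ _∼hypo_ (cong (p ++_) (++-identityʳ u)) (cong (p ++_) (++-identityʳ v)) (ctx p [] r)

  ∷-cong : ∀ c {u v : Word m} → u ∼hypo v → (c ∷ u) ∼hypo (c ∷ v)
  ∷-cong c = ++-congʳ [ c ]

  -- `knuth₁` for `x < y` and `knuth₃` for `x ≡ y` combine into one rule with a weak inequality;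
  -- likewise `knuth₂` and `knuth₄` in `knuth-right`.
  knuth-left : ∀ {x y z : Letter m} → x ≤ y → y < z → ∀ q →
               (y ∷ z ∷ x ∷ q) ∼hypo (y ∷ x ∷ z ∷ q)
  knuth-left {x} {y} x≤y y<z q with x ≟ y
  ... | yes refl = ctx [] q (gen (knuth₃ y<z))
  ... | no x≢y   = ctx [] q (gen (knuth₁ (Fin.≤∧≢⇒< x≤y x≢y) y<z))

  knuth-right : ∀ {x y z : Letter m} → x < y → y ≤ z → ∀ q →
                (x ∷ z ∷ y ∷ q) ∼hypo (z ∷ x ∷ y ∷ q)
  knuth-right {_} {y} {z} x<y y≤z q with y ≟ z
  ... | yes refl = ctx [] q (gen (knuth₄ x<y))
  ... | no y≢z   = ctx [] q (gen (knuth₂ x<y (Fin.≤∧≢⇒< y≤z y≢z)))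

  -- Schützenberger's involution, an anti-automorphism of the congruence.
  δ : Word m → Word m
  δ w = reverse (map opposite w)

  δ-++ : ∀ u v → δ (u ++ v) ≡ δ v ++ δ u
  δ-++ u v = trans (cong reverse (map-++ opposite u v)) (reverse-++ (map opposite u) _)

  δ-involutive : ∀ w → δ (δ w) ≡ w
  δ-involutive w = trans (cong reverse (reverse-map opposite (map opposite w)))
    (trans (reverse-involutive _)
      (trans (sym (map-∘ w)) (trans (map-cong opposite-involutive w) (map-id w))))

  length-δ : ∀ w → length (δ w) ≡ length w
  length-δ w = trans (length-reverse (map opposite w)) (length-map opposite w)

  opposite-≤ : {i j : Letter m} → i ≤ j → opposite j ≤ opposite i
  opposite-≤ {i} {j} i≤j =
    subst₂ ℕ._≤_ (sym (opposite-prop j)) (sym (opposite-prop i)) (ℕ.∸-monoʳ-≤ (suc m) (s≤s i≤j))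

  opposite-< : {i j : Letter m} → i < j → opposite j < opposite i
  opposite-< {i} {j} i<j =
    subst₂ ℕ._<_ (sym (opposite-prop j)) (sym (opposite-prop i))
      (ℕ.∸-monoʳ-< (s≤s i<j) (toℕ<n j))

  δ-All : ∀ {P Q : Letter m → Set} → (∀ {c} → P c → Q (opposite c)) →
          ∀ {w} → All P w → All Q (δ w)
  δ-All f ps = Perm.All-resp-↭ (Perm.↭-sym (Perm.↭-reverse _)) (All.map⁺ (All.map f ps))

  -- `δ` exchanges `knuth₁` with `knuth₂` and `knuth₃` with `knuth₄`, each read backwards, and maps
  -- each of the two quartic families to itself.
  δ-gen : ∀ {u v} → HypoGen u v → δ u ∼hypo δ v
  δ-gen (knuth₁ x<y y<z) = sym′ (gen (knuth₂ (opposite-< y<z) (opposite-< x<y)))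
  δ-gen (knuth₂ x<y y<z) = sym′ (gen (knuth₁ (opposite-< y<z) (opposite-< x<y)))
  δ-gen (knuth₃ x<y) = sym′ (gen (knuth₄ (opposite-< x<y)))
  δ-gen (knuth₄ x<y) = sym′ (gen (knuth₃ (opposite-< x<y)))
  δ-gen (quartic₁ t≤x x<y y≤z) = gen (quartic₁ (opposite-≤ y≤z) (opposite-< x<y) (opposite-≤ t≤x))
  δ-gen (quartic₂ t<x x≤y y<z) = gen (quartic₂ (opposite-< y<z) (opposite-≤ x≤y) (opposite-< t<x))

  δ-cong : ∀ {u v} → u ∼hypo v → δ u ∼hypo δ v
  δ-cong (gen g) = δ-gen g
  δ-cong (ctx {u} {v} p q r) = subst₂ _∼hypo_ (eq u) (eq v) (ctx (δ q) (δ p) (δ-cong r))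
    where
    eq : ∀ w → δ q ++ δ w ++ δ p ≡ δ (p ++ w ++ q)
    eq w = sym (trans (δ-++ p (w ++ q)) (trans (cong (_++ δ p) (δ-++ w q)) (++-assoc (δ q) (δ w) (δ p))))
  δ-cong refl′ = refl′
  δ-cong (sym′ r) = sym′ (δ-cong r)
  δ-cong (trans′ r s) = trans′ (δ-cong r) (δ-cong s)

  -- Decompositions of words.

  -- As produced by `ascent-or-decreasing`, `y ∷ K₁` and `K₂` form the longest weakly decreasing
  -- suffix, cut at the level of the letter `x` in front of it. Thus `x` can serve as the pivot for
  -- exchanging the two pieces.
  data Ascent : Word m → Set where
    ascent : ∀ H₁ {x y} K₁ K₂ → All (x <_) (y ∷ K₁) → All (_≤ x) K₂ →
             Ascent (H₁ ++ x ∷ (y ∷ K₁) ++ K₂)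

  Decreasing : Word m → Set
  Decreasing = AllPairs (λ x y → y ≤ x)

  split-decreasing : ∀ x {w} → Decreasing w →
    ∃₂ λ K₁ K₂ → w ≡ K₁ ++ K₂ × All (x <_) K₁ × All (_≤ x) K₂
  split-decreasing x [] = [] , [] , refl , [] , []
  split-decreasing x {c ∷ w} (c≥w ∷ dec) with x <? c
  ... | no x≮c = [] , c ∷ w , refl , [] , ℕ.≮⇒≥ x≮c ∷ All.map (λ d≤c → Fin.≤-trans d≤c (ℕ.≮⇒≥ x≮c)) c≥w
  ... | yes x<c with split-decreasing x dec
  ...   | K₁ , K₂ , refl , x<K₁ , K₂≤x = c ∷ K₁ , K₂ , refl , x<c ∷ x<K₁ , K₂≤x

  ascent-or-decreasing : ∀ w → Ascent w ⊎ Decreasing w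
  ascent-or-decreasing [] = inj₂ []
  ascent-or-decreasing (x ∷ w) with ascent-or-decreasing w
  ... | inj₁ (ascent H₁ K₁ K₂ p q) = inj₁ (ascent (x ∷ H₁) K₁ K₂ p q)
  ... | inj₂ dec with split-decreasing x dec
  ...   | []     , _  , refl , _ , q = inj₂ (q ∷ dec)
  ...   | y ∷ K₁ , K₂ , refl , p , q = inj₁ (ascent [] K₁ K₂ p q)

  data LastAbove (l : Letter m) : Word m → Set where
    last-above : ∀ L₁ x L₂ → l ≤ x → All (_< l) L₂ → LastAbove l (L₁ ++ x ∷ L₂)

  last-above? : ∀ l w → LastAbove l w ⊎ All (_< l) w
  last-above? l [] = inj₂ []
  last-above? l (x ∷ w) with last-above? l w
  ... | inj₁ (last-above L₁ y L₂ p q) = inj₁ (last-above (x ∷ L₁) y L₂ p q)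
  ... | inj₂ w<l with l ≤? x
  ...   | yes l≤x = inj₁ (last-above [] x w l≤x w<l)
  ...   | no l≰x  = inj₂ (ℕ.≰⇒> l≰x ∷ w<l)

  data FirstAbove (t : Letter m) : Word m → Set where
    first-above : ∀ L₁ x L₂ → All (_≤ t) L₁ → t < x → FirstAbove t (L₁ ++ x ∷ L₂)

  first-above? : ∀ t w → FirstAbove t w ⊎ All (_≤ t) w
  first-above? t [] = inj₂ []
  first-above? t (x ∷ w) with t <? x
  ... | yes t<x = inj₁ (first-above [] x w [] t<x)
  ... | no t≮x with first-above? t w
  ...   | inj₁ (first-above L₁ y L₂ p q) = inj₁ (first-above (x ∷ L₁) y L₂ (ℕ.≮⇒≥ t≮x ∷ p) q)
  ...   | inj₂ w≤t = inj₂ (ℕ.≮⇒≥ t≮x ∷ w≤t)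

  length-∷ʳ : ∀ (w : Word m) {c} → length (w ∷ʳ c) ≡ suc (length w)
  length-∷ʳ w = trans (length-++ w) (ℕ.+-comm (length w) 1)

  -- The only left blocks that the reductions in `flip` leave over.
  data Short (l : Letter m) : Word m → Set where
    empty  : Short l []
    single : ∀ {t} → t < l → Short l [ t ]

  data EndView : Word m → Set where
    none : EndView []
    one  : ∀ h → EndView [ h ]
    two  : ∀ z h → EndView (z ∷ h ∷ [])
    long : ∀ c H z h → EndView ((c ∷ H) ++ z ∷ h ∷ [])

  endView : ∀ w → EndView w
  endView [] = none
  endView (c ∷ w) with endView w
  ... | none         = one c
  ... | one h        = two c h
  ... | two z h      = long c [] z h
  ... | long d H z h = long c (d ∷ H) z h

  decreasing-end : ∀ H {z h} → Decreasing (H ++ z ∷ h ∷ []) → All (z ≤_) H × h ≤ z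
  decreasing-end [] ((h≤z ∷ []) ∷ _) = [] , h≤z
  decreasing-end (c ∷ H) (c≥ ∷ dec) with decreasing-end H dec
  ... | z≤H , h≤z = All.head (All.++⁻ʳ H c≥) ∷ z≤H , h≤z

  -- Commutation of a low and a high block next to a pivot letter.

  -- The bound on the total length drives the induction: `SwapAfter` at `suc n` is derived from both
  -- statements at `n`.
  SwapAfter SwapBefore : ℕ → Set
  SwapAfter n = ∀ (t : Letter m) L K → All (_≤ t) L → All (t <_) K → length L + length K ℕ.≤ n →
                ∀ q → (t ∷ L ++ K ++ q) ∼hypo (t ∷ K ++ L ++ q)
  SwapBefore n = ∀ (b : Letter m) L K → All (_< b) L → All (b ≤_) K → length L + length K ℕ.≤ n →
                 ∀ q → (L ++ K ++ b ∷ q) ∼hypo (K ++ L ++ b ∷ q)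

  -- `δ` brings the pivot `b` to the front and reverses the order of letters, so that `K` becomes
  -- the low block and `L` the high one.
  swap-dual : ∀ {n} → SwapAfter n → SwapBefore n
  swap-dual A b L K L<b b≤K size q = subst₂ _∼hypo_ (eq L K) (eq K L) (ctx [] q (δ-cong
    (A (opposite b) (δ K) (δ L) (δ-All opposite-≤ b≤K) (δ-All opposite-< L<b)
       (ℕ.≤-trans (ℕ.≤-reflexive
         (trans (cong₂ _+_ (length-δ K) (length-δ L)) (ℕ.+-comm (length K) _))) size) [])))
    where
    eq : ∀ M N → δ (opposite b ∷ δ N ++ δ M ++ []) ++ q ≡ M ++ N ++ b ∷ q
    eq M N = begin
      δ (opposite b ∷ δ N ++ δ M ++ []) ++ q
        ≡⟨ cong (λ w → δ (opposite b ∷ w) ++ q)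
             (trans (cong (δ N ++_) (++-identityʳ (δ M))) (sym (δ-++ M N))) ⟩
      δ ([ opposite b ] ++ δ (M ++ N)) ++ q
        ≡⟨ cong (_++ q) (δ-++ [ opposite b ] (δ (M ++ N))) ⟩
      (δ (δ (M ++ N)) ++ [ opposite (opposite b) ]) ++ q
        ≡⟨ cong₂ (λ w c → (w ++ [ c ]) ++ q) (δ-involutive (M ++ N)) (opposite-involutive b) ⟩
      ((M ++ N) ++ [ b ]) ++ q ≡⟨ ++-assoc (M ++ N) [ b ] q ⟩
      (M ++ N) ++ b ∷ q ≡⟨ ++-assoc M N (b ∷ q) ⟩
      M ++ N ++ b ∷ q ∎
      where open ≡-Reasoning

  private
    enlarge : ∀ {a c n} b → a + b ≡ c → c ℕ.≤ n → a ℕ.≤ n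
    enlarge b refl = ℕ.≤-trans (ℕ.m≤m+n _ b)

  open SetoidReasoning hypo-setoid

  -- The chains from here to `flip-two` serve the base cases of `flip`, in which the left block has
  -- at most one letter and the right block at most two.
  unflip-two : ∀ {l a h z : Letter m} → l ≤ a → a < h → h ≤ z → ∀ q →
             (z ∷ a ∷ l ∷ h ∷ q) ∼hypo (a ∷ l ∷ z ∷ h ∷ q)
  unflip-two {l} {a} {h} {z} l≤a a<h h≤z q = begin
    z ∷ a ∷ l ∷ h ∷ q  ≈⟨ ∷-cong z (knuth-left l≤a a<h q) ⟨
    z ∷ a ∷ h ∷ l ∷ q  ≈⟨ ctx [] q (gen (quartic₁ l≤a a<h h≤z)) ⟨
    a ∷ z ∷ l ∷ h ∷ q  ≈⟨ knuth-left l≤a (ℕ.<-≤-trans a<h h≤z) (h ∷ q) ⟩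
    a ∷ l ∷ z ∷ h ∷ q  ∎

  flip-one-two : ∀ {t l a h z : Letter m} → t < l → l ≤ a → a < h → h ≤ z → ∀ q →
                 (a ∷ t ∷ z ∷ h ∷ l ∷ q) ∼hypo (a ∷ t ∷ l ∷ z ∷ h ∷ q)
  flip-one-two {t} {l} {a} {h} {z} t<l l≤a a<h h≤z q = begin
    -- `z` is carried to the front, a quartic relation then takes `h` past `l`, and `z` returns to
    -- its place.
    a ∷ t ∷ z ∷ h ∷ l ∷ q  ≈⟨ ∷-cong a (knuth-right t<h h≤z (l ∷ q)) ⟩
    a ∷ z ∷ t ∷ h ∷ l ∷ q  ≈⟨ ctx [] (l ∷ q) (gen (quartic₁ t≤a a<h h≤z)) ⟩
    z ∷ a ∷ h ∷ t ∷ l ∷ q  ≈⟨ ∷-cong z (knuth-left t≤a a<h (l ∷ q)) ⟩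
    z ∷ a ∷ t ∷ h ∷ l ∷ q  ≈⟨ ∷-cong z (ctx [] q (gen (quartic₂ t<l l≤a a<h))) ⟩
    z ∷ t ∷ a ∷ l ∷ h ∷ q  ≈⟨ knuth-right t<a a≤z (l ∷ h ∷ q) ⟨
    t ∷ z ∷ a ∷ l ∷ h ∷ q  ≈⟨ ∷-cong t (unflip-two l≤a a<h h≤z q) ⟩
    t ∷ a ∷ l ∷ z ∷ h ∷ q  ≈⟨ knuth-right t<l l≤a (z ∷ h ∷ q) ⟩
    a ∷ t ∷ l ∷ z ∷ h ∷ q  ∎
    where
    t<a = ℕ.<-≤-trans t<l l≤a
    t≤a = ℕ.<⇒≤ t<a
    t<h = ℕ.<-trans t<a a<h
    a≤z = Fin.≤-trans (ℕ.<⇒≤ a<h) h≤z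

  flip-one : ∀ {t l a h : Letter m} → t < l → l ≤ a → a < h → ∀ q →
             (a ∷ t ∷ h ∷ l ∷ q) ∼hypo (a ∷ t ∷ l ∷ h ∷ q)
  flip-one {t} {l} {a} {h} t<l l≤a a<h q = begin
    a ∷ t ∷ h ∷ l ∷ q  ≈⟨ ctx [] q (gen (quartic₂ t<l l≤a a<h)) ⟩
    t ∷ a ∷ l ∷ h ∷ q  ≈⟨ knuth-right t<l l≤a (h ∷ q) ⟩
    a ∷ t ∷ l ∷ h ∷ q  ∎

  flip-two : ∀ {l a h z : Letter m} → l ≤ a → a < h → h ≤ z → ∀ q →
              (a ∷ z ∷ h ∷ l ∷ q) ∼hypo (a ∷ l ∷ z ∷ h ∷ q)
  flip-two {l} {a} {h} {z} l≤a a<h h≤z q = begin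
    a ∷ z ∷ h ∷ l ∷ q  ≈⟨ knuth-right a<h h≤z (l ∷ q) ⟩
    z ∷ a ∷ h ∷ l ∷ q  ≈⟨ ∷-cong z (knuth-left l≤a a<h q) ⟩
    z ∷ a ∷ l ∷ h ∷ q  ≈⟨ unflip-two l≤a a<h h≤z q ⟩
    a ∷ l ∷ z ∷ h ∷ q  ∎

  module Step {n} (A : SwapAfter n) (B : SwapBefore n) where

    -- The increment of the induction: to exchange `L ∷ʳ l` with `H` after `a`, first move `l`
    -- across `H`, then exchange `L` with `H`.
    FlipAt : Letter m → Word m → Word m → Letter m → Set
    FlipAt a L H l = ∀ q → (a ∷ L ++ H ++ l ∷ q) ∼hypo (a ∷ L ++ l ∷ H ++ q)

    -- With one letter to spare, the induction hypothesis covers both `L` and `L ∷ʳ l`, and it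
    -- brings both sides to the word in which `H` directly follows `a`.
    flip-smaller : ∀ {a l} L H → All (_≤ a) L → All (a <_) H → l ≤ a →
                   length L + length H ℕ.< n → FlipAt a L H l
    flip-smaller {a} {l} L H L≤a a<H l≤a size q = begin
      a ∷ L ++ H ++ l ∷ q         ≈⟨ A a L H L≤a a<H (ℕ.<⇒≤ size) (l ∷ q) ⟩
      a ∷ H ++ L ++ l ∷ q         ≡⟨ cong (λ w → a ∷ H ++ w) (++-assoc L [ l ] q) ⟨
      a ∷ H ++ (L ∷ʳ l) ++ q      ≈⟨ A a (L ∷ʳ l) H (All.∷ʳ⁺ L≤a l≤a) a<H size′ q ⟨
      a ∷ (L ∷ʳ l) ++ H ++ q      ≡⟨ cong (a ∷_) (++-assoc L [ l ] (H ++ q)) ⟩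
      a ∷ L ++ l ∷ H ++ q         ∎
      where
      size′ : length (L ∷ʳ l) + length H ℕ.≤ n
      size′ = ℕ.≤-trans (ℕ.≤-reflexive (trans (cong (_+ length H) (length-++ L))
        (trans (ℕ.+-assoc (length L) 1 _) (ℕ.+-suc (length L) _)))) size

    -- The letter `x` is a pivot inside `H`. As `l ≤ a < x`, it lets `K₂` and `l` together pass `K`;
    -- then `l` has only the shorter word `H₁ ++ x ∷ K₂` to cross, after which `x` restores the
    -- order of `K` and `K₂`.
    flip-ascent : ∀ {a l} L H → All (_≤ a) L → All (a <_) H → l ≤ a →
                  length L + length H ℕ.≤ n → Ascent H → FlipAt a L H l
    flip-ascent {a} {l} L _ L≤a a<H l≤a size (ascent H₁ {x} {y} K₁ K₂ x<K K₂≤x) q = begin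
      a ∷ L ++ (H₁ ++ x ∷ K ++ K₂) ++ l ∷ q
        ≡⟨ cong (λ w → a ∷ L ++ w) (assoc K K₂ (l ∷ q)) ⟩
      a ∷ L ++ H₁ ++ x ∷ K ++ K₂ ++ l ∷ q
        ≡⟨ cong (λ w → a ∷ L ++ H₁ ++ x ∷ K ++ w) (++-assoc K₂ [ l ] q) ⟨
      a ∷ L ++ H₁ ++ x ∷ K ++ (K₂ ∷ʳ l) ++ q
        ≈⟨ ++-congʳ (a ∷ L) (++-congʳ H₁ (A x (K₂ ∷ʳ l) K (All.∷ʳ⁺ K₂≤x l≤x) x<K size₁ q)) ⟨
      a ∷ L ++ H₁ ++ x ∷ (K₂ ∷ʳ l) ++ K ++ q
        ≡⟨ cong (λ w → a ∷ L ++ H₁ ++ x ∷ w) (++-assoc K₂ [ l ] (K ++ q)) ⟩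
      a ∷ L ++ H₁ ++ x ∷ K₂ ++ l ∷ K ++ q
        ≡⟨ cong (λ w → a ∷ L ++ w) (++-assoc H₁ (x ∷ K₂) (l ∷ K ++ q)) ⟨
      a ∷ L ++ (H₁ ++ x ∷ K₂) ++ l ∷ K ++ q
        ≈⟨ flip-smaller L (H₁ ++ x ∷ K₂) L≤a (All.++⁺ a<H₁ (a<x ∷ a<K₂)) l≤a size₂ (K ++ q) ⟩
      a ∷ L ++ l ∷ (H₁ ++ x ∷ K₂) ++ K ++ q
        ≡⟨ cong (λ w → a ∷ L ++ l ∷ w) (++-assoc H₁ (x ∷ K₂) (K ++ q)) ⟩
      a ∷ L ++ l ∷ H₁ ++ x ∷ K₂ ++ K ++ q
        ≈⟨ ++-congʳ (a ∷ L) (++-congʳ (l ∷ H₁) (A x K₂ K K₂≤x x<K size₃ q)) ⟩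
      a ∷ L ++ l ∷ H₁ ++ x ∷ K ++ K₂ ++ q
        ≡⟨ cong (λ w → a ∷ L ++ l ∷ w) (assoc K K₂ q) ⟨
      a ∷ L ++ l ∷ (H₁ ++ x ∷ K ++ K₂) ++ q ∎
      where
      K = y ∷ K₁
      assoc : ∀ M N r → (H₁ ++ x ∷ M ++ N) ++ r ≡ H₁ ++ x ∷ M ++ N ++ r
      assoc M N r = trans (++-assoc H₁ (x ∷ M ++ N) r) (cong (λ w → H₁ ++ x ∷ w) (++-assoc M N r))
      a<H₁ = All.++⁻ˡ H₁ a<H
      a<x : a < x
      a<x = All.head (All.++⁻ʳ H₁ a<H)
      a<K₂ = All.++⁻ʳ K (All.tail (All.++⁻ʳ H₁ a<H))
      l≤x = Fin.≤-trans l≤a (ℕ.<⇒≤ a<x)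
      size₀ : length L + (length H₁ + suc (suc (length K₁ + length K₂))) ℕ.≤ n
      size₀ = subst (ℕ._≤ n) (cong (length L +_) (trans (length-++ H₁)
        (cong (λ k → length H₁ + suc (suc k)) (length-++ K₁)))) size
      size₁ : length (K₂ ∷ʳ l) + length K ℕ.≤ n
      size₁ rewrite length-++ K₂ {[ l ]} = enlarge (length L + length H₁)
        (arith (length L) (length H₁) (length K₁) (length K₂)) size₀
        where
        arith : ∀ ℓ h k₁ k₂ → (k₂ + 1) + suc k₁ + (ℓ + h) ≡ ℓ + (h + suc (suc (k₁ + k₂)))
        arith = solve-∀
      size₂ : length L + length (H₁ ++ x ∷ K₂) ℕ.< n
      size₂ rewrite length-++ H₁ {x ∷ K₂} = enlarge (length K₁)
        (arith (length L) (length H₁) (length K₁) (length K₂)) size₀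
        where
        arith : ∀ ℓ h k₁ k₂ → suc (ℓ + (h + suc k₂)) + k₁ ≡ ℓ + (h + suc (suc (k₁ + k₂)))
        arith = solve-∀
      size₃ : length K₂ + length K ℕ.≤ n
      size₃ = enlarge (length L + length H₁ + 1)
        (arith (length L) (length H₁) (length K₁) (length K₂)) size₀
        where
        arith : ∀ ℓ h k₁ k₂ → k₂ + suc k₁ + (ℓ + h + 1) ≡ ℓ + (h + suc (suc (k₁ + k₂)))
        arith = solve-∀

    -- The letter `x ≥ l` replaces `a` as the pivot, and the left block shrinks to `L₂`.
    flip-last-above : ∀ {a l} L H → All (a <_) H → All (_≤ a) L →
                      length L + length H ℕ.≤ n → LastAbove l L → FlipAt a L H l
    flip-last-above {a} {l} _ H a<H L≤a size (last-above L₁ x L₂ l≤x L₂<l) q = begin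
      a ∷ (L₁ ++ x ∷ L₂) ++ H ++ l ∷ q
        ≡⟨ cong (a ∷_) (++-assoc L₁ (x ∷ L₂) (H ++ l ∷ q)) ⟩
      a ∷ L₁ ++ x ∷ L₂ ++ H ++ l ∷ q
        ≈⟨ ++-congʳ (a ∷ L₁) (flip-smaller L₂ H
             (All.map (λ c<l → Fin.≤-trans (ℕ.<⇒≤ c<l) l≤x) L₂<l)
             (All.map (ℕ.≤-<-trans (All.head (All.++⁻ʳ L₁ L≤a))) a<H) l≤x size′ q) ⟩
      a ∷ L₁ ++ x ∷ L₂ ++ l ∷ H ++ q
        ≡⟨ cong (a ∷_) (++-assoc L₁ (x ∷ L₂) (l ∷ H ++ q)) ⟨
      a ∷ (L₁ ++ x ∷ L₂) ++ l ∷ H ++ q ∎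
      where
      arith : ∀ ℓ₁ ℓ₂ h → suc (ℓ₂ + h) + ℓ₁ ≡ ℓ₁ + suc ℓ₂ + h
      arith = solve-∀
      size′ : length L₂ + length H ℕ.< n
      size′ = enlarge (length L₁) (arith (length L₁) (length L₂) (length H))
        (subst (λ k → k + length H ℕ.≤ n) (length-++ L₁) size)

    -- Since `t < x ≤ a`, the later letter `x` makes `a` and `t` commute. Once `t` stands in front
    -- of `a`, it no longer belongs to the left block.
    flip-first-above : ∀ {a l} t L H → t ≤ a → All (a <_) H → All (_≤ a) L → l ≤ a →
                       length (t ∷ L) + length H ℕ.≤ n → FirstAbove t L → FlipAt a (t ∷ L) H l
    flip-first-above {a} {l} t _ H t≤a a<H L≤a l≤a size (first-above L₁ x L₂ L₁≤t t<x) q = begin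
      a ∷ t ∷ (L₁ ++ x ∷ L₂) ++ H ++ l ∷ q  ≈⟨ exchange (H ++ l ∷ q) ⟩
      t ∷ a ∷ (L₁ ++ x ∷ L₂) ++ H ++ l ∷ q
        ≈⟨ ∷-cong t (flip-smaller (L₁ ++ x ∷ L₂) H L≤a a<H l≤a size q) ⟩
      t ∷ a ∷ (L₁ ++ x ∷ L₂) ++ l ∷ H ++ q  ≈⟨ exchange (l ∷ H ++ q) ⟨
      a ∷ t ∷ (L₁ ++ x ∷ L₂) ++ l ∷ H ++ q  ∎
      where
      L₁<x = All.map (λ c≤t → ℕ.≤-<-trans c≤t t<x) L₁≤t
      x≤a : x ≤ a
      x≤a = All.head (All.++⁻ʳ L₁ L≤a)
      arith : ∀ ℓ₁ ℓ₂ h → suc (ℓ₁ + 1) + (ℓ₂ + h) ≡ suc (ℓ₁ + suc ℓ₂) + h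
      arith = solve-∀
      size₁ : length (t ∷ L₁) + 1 ℕ.≤ n
      size₁ = enlarge (length L₂ + length H) (arith (length L₁) (length L₂) (length H))
        (subst (λ k → suc k + length H ℕ.≤ n) (length-++ L₁) size)
      exchange : ∀ r → (a ∷ t ∷ (L₁ ++ x ∷ L₂) ++ r) ∼hypo (t ∷ a ∷ (L₁ ++ x ∷ L₂) ++ r)
      exchange r = begin
        a ∷ t ∷ (L₁ ++ x ∷ L₂) ++ r  ≡⟨ cong (λ w → a ∷ t ∷ w) (++-assoc L₁ (x ∷ L₂) r) ⟩
        -- `a` crosses `t ∷ L₁` to stand next to the pivot `x`, and goes back across `L₁` alone.
        a ∷ t ∷ L₁ ++ x ∷ L₂ ++ r
          ≈⟨ B x (t ∷ L₁) [ a ] (t<x ∷ L₁<x) (x≤a ∷ []) size₁ (L₂ ++ r) ⟨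
        t ∷ L₁ ++ a ∷ x ∷ L₂ ++ r
          ≈⟨ ∷-cong t (B x L₁ [ a ] L₁<x (x≤a ∷ []) (ℕ.<⇒≤ size₁) (L₂ ++ r)) ⟩
        t ∷ a ∷ L₁ ++ x ∷ L₂ ++ r    ≡⟨ cong (λ w → t ∷ a ∷ w) (++-assoc L₁ (x ∷ L₂) r) ⟨
        t ∷ a ∷ (L₁ ++ x ∷ L₂) ++ r  ∎

    -- Here `t` is a pivot separating `y ∷ L` from `H` and `l`. It parks `y ∷ L` behind them, so
    -- that only `t` remains between `a` and `H` while `l` moves.
    flip-none-above : ∀ {a l} t y L H → t < l → l ≤ a → All (a <_) H → All (_≤ t) (y ∷ L) →
                      length (t ∷ y ∷ L) + length H ℕ.≤ n → FlipAt a (t ∷ y ∷ L) H l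
    flip-none-above {a} {l} t y L H t<l l≤a a<H L≤t size q = begin
      a ∷ t ∷ yL ++ H ++ l ∷ q       ≡⟨ cong (λ w → a ∷ t ∷ yL ++ w) (++-assoc H [ l ] q) ⟨
      a ∷ t ∷ yL ++ (H ∷ʳ l) ++ q
        ≈⟨ ∷-cong a (A t yL (H ∷ʳ l) L≤t (All.∷ʳ⁺ t<H t<l) size₁ q) ⟩
      a ∷ t ∷ (H ∷ʳ l) ++ yL ++ q    ≡⟨ cong (λ w → a ∷ t ∷ w) (++-assoc H [ l ] (yL ++ q)) ⟩
      a ∷ t ∷ H ++ l ∷ yL ++ q
        ≈⟨ flip-smaller [ t ] H (ℕ.<⇒≤ t<a ∷ []) a<H l≤a size₂ (yL ++ q) ⟩
      a ∷ t ∷ l ∷ H ++ yL ++ q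
        ≈⟨ ∷-cong a (A t yL (l ∷ H) L≤t (t<l ∷ t<H) size₃ q) ⟨
      a ∷ t ∷ yL ++ l ∷ H ++ q       ∎
      where
      yL = y ∷ L
      t<a : t < a
      t<a = ℕ.<-≤-trans t<l l≤a
      t<H = All.map (ℕ.<-trans t<a) a<H
      size₃ : length yL + suc (length H) ℕ.≤ n
      size₃ = subst (ℕ._≤ n) (sym (ℕ.+-suc (length yL) (length H))) size
      size₁ : length yL + length (H ∷ʳ l) ℕ.≤ n
      size₁ = subst (λ k → length yL + k ℕ.≤ n)
        (sym (trans (length-++ H) (ℕ.+-comm (length H) 1))) size₃
      size₂ : suc (suc (length H)) ℕ.≤ n
      size₂ = ℕ.≤-trans (s≤s (s≤s (ℕ.m≤n+m (length H) (length L)))) size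

    -- The final letter `h`, a minimum of the right block, is a pivot for `SwapBefore`: the rest of
    -- that block is moved in front of `a`, and `l` has only `h` to cross.
    flip-long : ∀ {a l} L c H z h → All (_≤ a) L → l ≤ a → a < z → a < h →
                All (z ≤_) (c ∷ H) → h ≤ z → length L + suc (length H + 2) ℕ.≤ n →
                FlipAt a L ((c ∷ H) ++ z ∷ h ∷ []) l
    flip-long {a} {l} L c H z h L≤a l≤a a<z a<h z≤H h≤z size q = begin
      P ++ (cH ++ z ∷ h ∷ []) ++ l ∷ q    ≡⟨ cong (P ++_) (++-assoc cH (z ∷ h ∷ []) (l ∷ q)) ⟩
      P ++ cH ++ z ∷ h ∷ l ∷ q            ≡⟨ cong (P ++_) (++-assoc cH [ z ] (h ∷ l ∷ q)) ⟨
      P ++ (cH ∷ʳ z) ++ h ∷ l ∷ q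
        ≈⟨ B h P (cH ∷ʳ z) (below a<h) (All.∷ʳ⁺ (All.map (Fin.≤-trans h≤z) z≤H) h≤z) size₁ (l ∷ q) ⟩
      (cH ∷ʳ z) ++ P ++ h ∷ l ∷ q         ≡⟨ ++-assoc cH [ z ] (P ++ h ∷ l ∷ q) ⟩
      cH ++ z ∷ P ++ h ∷ l ∷ q
        ≈⟨ ++-congʳ cH (∷-cong z (flip-smaller L [ h ] L≤a (a<h ∷ []) l≤a size₂ q)) ⟩
      cH ++ z ∷ P ++ l ∷ h ∷ q            ≡⟨ cong (λ w → cH ++ z ∷ w) (++-assoc P [ l ] (h ∷ q)) ⟨
      cH ++ z ∷ (P ∷ʳ l) ++ h ∷ q
        -- The way back takes two steps, because `P ∷ʳ l` and `cH ∷ʳ z` together may exceed the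
        -- bound by one: `z` is passed with pivot `h`, then `cH` with pivot `z`.
        ≈⟨ ++-congʳ cH (B h (P ∷ʳ l) [ z ] (below′ a<h) (h≤z ∷ []) size₃ q) ⟨
      cH ++ (P ∷ʳ l) ++ z ∷ h ∷ q
        ≈⟨ B z (P ∷ʳ l) cH (below′ a<z) z≤H size₄ (h ∷ q) ⟨
      (P ∷ʳ l) ++ cH ++ z ∷ h ∷ q         ≡⟨ ++-assoc P [ l ] (cH ++ z ∷ h ∷ q) ⟩
      P ++ l ∷ cH ++ z ∷ h ∷ q            ≡⟨ cong (λ w → P ++ l ∷ w) (++-assoc cH (z ∷ h ∷ []) q) ⟨
      P ++ l ∷ (cH ++ z ∷ h ∷ []) ++ q    ∎
      where
      P = a ∷ L
      cH = c ∷ H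
      below : ∀ {d} → a < d → All (_< d) P
      below a<d = a<d ∷ All.map (λ x≤a → ℕ.≤-<-trans x≤a a<d) L≤a
      below′ : ∀ {d} → a < d → All (_< d) (P ∷ʳ l)
      below′ a<d = All.∷ʳ⁺ (below a<d) (ℕ.≤-<-trans l≤a a<d)
      arith₁ : ∀ ℓ h′ → suc ℓ + (suc h′ + 1) + 0 ≡ ℓ + suc (h′ + 2)
      arith₁ = solve-∀
      arith₂ : ∀ ℓ h′ → suc (ℓ + 1) + suc h′ ≡ ℓ + suc (h′ + 2)
      arith₂ = solve-∀
      arith₃ : ∀ ℓ h′ → suc ℓ + 1 + 1 + h′ ≡ ℓ + suc (h′ + 2)
      arith₃ = solve-∀
      arith₄ : ∀ ℓ h′ → suc ℓ + 1 + suc h′ + 0 ≡ ℓ + suc (h′ + 2)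
      arith₄ = solve-∀
      size₁ : length P + length (cH ∷ʳ z) ℕ.≤ n
      size₁ rewrite length-++ H {[ z ]} = enlarge 0 (arith₁ (length L) (length H)) size
      size₂ : length L + 1 ℕ.< n
      size₂ = enlarge (suc (length H)) (arith₂ (length L) (length H)) size
      size₃ : length (P ∷ʳ l) + 1 ℕ.≤ n
      size₃ rewrite length-++ L {[ l ]} = enlarge (length H) (arith₃ (length L) (length H)) size
      size₄ : length (P ∷ʳ l) + length cH ℕ.≤ n
      size₄ rewrite length-++ L {[ l ]} = enlarge 0 (arith₄ (length L) (length H)) size

    flip-short : ∀ {a l} L H → Short l L → EndView H → Decreasing H →
                 All (_≤ a) L → All (a <_) H → l ≤ a → length L + length H ℕ.≤ n → FlipAt a L H l
    flip-short L _ _ none _ _ _ _ _ q = refl′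
    flip-short _ _ empty (one h) _ _ (a<h ∷ []) l≤a _ q = knuth-left l≤a a<h q
    flip-short _ _ (single t<l) (one h) _ _ (a<h ∷ []) l≤a _ q = flip-one t<l l≤a a<h q
    flip-short _ _ empty (two z h) ((h≤z ∷ []) ∷ _) _ (_ ∷ a<h ∷ []) l≤a _ q = flip-two l≤a a<h h≤z q
    flip-short _ _ (single t<l) (two z h) ((h≤z ∷ []) ∷ _) _ (_ ∷ a<h ∷ []) l≤a _ q =
      flip-one-two t<l l≤a a<h h≤z q
    flip-short L _ _ (long c H z h) dec L≤a a<H l≤a size q
      with decreasing-end (c ∷ H) dec | All.++⁻ʳ (c ∷ H) a<H
    ... | z≤H , h≤z | a<z ∷ a<h ∷ [] = flip-long L c H z h L≤a l≤a a<z a<h z≤H h≤z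
      (subst (λ k → length L + suc k ℕ.≤ n) (length-++ H) size) q

    -- The reductions above apply unless `H` is weakly decreasing and `L` consists of at most one
    -- letter, which is smaller than `l`.
    flip : ∀ {a l} L H → All (_≤ a) L → All (a <_) H → l ≤ a →
           length L + length H ℕ.≤ n → FlipAt a L H l
    flip {a} {l} L H L≤a a<H l≤a size with ascent-or-decreasing H
    ... | inj₁ asc = flip-ascent L H L≤a a<H l≤a size asc
    ... | inj₂ dec with last-above? l L
    ...   | inj₁ abv = flip-last-above L H a<H L≤a size abv
    ...   | inj₂ L<l = go L L≤a L<l size
      where
      go : ∀ L → All (_≤ a) L → All (_< l) L → length L + length H ℕ.≤ n → FlipAt a L H l
      go [] L≤a _ size = flip-short [] H empty (endView H) dec L≤a a<H l≤a size
      go (t ∷ L) L≤a L<l size with first-above? t L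
      ... | inj₁ abv = flip-first-above t L H (All.head L≤a) a<H (All.tail L≤a) l≤a size abv
      go (t ∷ []) L≤a (t<l ∷ []) size | inj₂ _ =
        flip-short [ t ] H (single t<l) (endView H) dec L≤a a<H l≤a size
      go (t ∷ y ∷ L) _ (t<l ∷ _) size | inj₂ L≤t =
        flip-none-above t y L H t<l l≤a a<H L≤t size

  swap-after-bounded : ∀ n → SwapAfter n
  swap-after-bounded n t L K L≤t t<K size q with initLast L
  swap-after-bounded n t _ K L≤t t<K size q | [] = refl′
  swap-after-bounded zero t _ K L≤t t<K size q | L ∷ʳ′ l
    with () ← subst (λ k → k + length K ℕ.≤ 0) (length-∷ʳ L) size
  swap-after-bounded (suc n) t _ K L≤t t<K size q | L ∷ʳ′ l = begin
    t ∷ (L ∷ʳ l) ++ K ++ q   ≡⟨ cong (t ∷_) (++-assoc L [ l ] (K ++ q)) ⟩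
    t ∷ L ++ l ∷ K ++ q      ≈⟨ flip L K L₀≤t t<K l≤t size′ q ⟨
    t ∷ L ++ K ++ l ∷ q      ≈⟨ IH t L K L₀≤t t<K size′ (l ∷ q) ⟩
    t ∷ K ++ L ++ l ∷ q      ≡⟨ cong (λ w → t ∷ K ++ w) (++-assoc L [ l ] q) ⟨
    t ∷ K ++ (L ∷ʳ l) ++ q   ∎
    where
    IH = swap-after-bounded n
    open Step IH (swap-dual IH)
    L₀≤t = proj₁ (All.∷ʳ⁻ L≤t)
    l≤t = proj₂ (All.∷ʳ⁻ L≤t)
    size′ : length L + length K ℕ.≤ n
    size′ = ℕ.≤-pred (subst (λ k → k + length K ℕ.≤ suc n) (length-∷ʳ L) size)

  swap-after : ∀ t L K → All (_≤ t) L → All (t <_) K → ∀ q →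
               (t ∷ L ++ K ++ q) ∼hypo (t ∷ K ++ L ++ q)
  swap-after t L K L≤t t<K = swap-after-bounded _ t L K L≤t t<K ℕ.≤-refl

  swap-before : ∀ b L K → All (_< b) L → All (b ≤_) K → ∀ q →
                (L ++ K ++ b ∷ q) ∼hypo (K ++ L ++ b ∷ q)
  swap-before b L K L<b b≤K = swap-dual (swap-after-bounded _) b L K L<b b≤K ℕ.≤-refl

  -- Splitting a word at a consecutive pair.

  lows highs : Letter m → Word m → Word m
  lows a = filter (_≤? a)
  highs a = filter (a <?_)

  Gap : Letter m → Letter m → Word m → Set
  Gap a b = All (λ c → c ≤ a ⊎ b ≤ c)

  highs-above : ∀ {a b} w → Gap a b w → All (b ≤_) (highs a w)
  highs-above {a} w gap =
    All.zipWith above (All.all-filter (a <?_) w , All.filter⁺ (a <?_) gap)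
    where
    above : ∀ {b c : Letter m} → a < c × (c ≤ a ⊎ b ≤ c) → b ≤ c
    above (a<c , inj₁ c≤a) = contradiction c≤a (ℕ.<⇒≱ a<c)
    above (_   , inj₂ b≤c) = b≤c

  lows-below : ∀ {a b : Letter m} → a < b → ∀ w → All (_< b) (lows a w)
  lows-below {a} a<b w = All.map (λ c≤a → ℕ.≤-<-trans c≤a a<b) (All.all-filter (_≤? a) w)

  separate-before : ∀ {a b} → a < b → ∀ w → Gap a b w → ∀ q →
                    (w ++ b ∷ q) ∼hypo (lows a w ++ highs a w ++ b ∷ q)
  separate-before a<b [] _ q = refl′
  separate-before {a} {b} a<b (c ∷ w) (_ ∷ gap) q with c ≤? a
  ... | yes c≤a rewrite filter-accept (_≤? a) {c} {w} c≤a | filter-reject (a <?_) {c} {w} (ℕ.≤⇒≯ c≤a) =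
    ∷-cong c (separate-before a<b w gap q)
  separate-before {a} {b} a<b (c ∷ w) (inj₁ c≤a ∷ gap) q | no c≰a = contradiction c≤a c≰a
  separate-before {a} {b} a<b (c ∷ w) (inj₂ b≤c ∷ gap) q | no c≰a
    rewrite filter-reject (_≤? a) {c} {w} c≰a | filter-accept (a <?_) {c} {w} (ℕ.≰⇒> c≰a) = begin
    c ∷ w ++ b ∷ q                    ≈⟨ ∷-cong c (separate-before a<b w gap q) ⟩
    c ∷ lows a w ++ highs a w ++ b ∷ q
      -- `c` cannot pass the low block directly, as the pivot `b` is not adjacent to it. The blocks
      -- are exchanged, and exchanged back with `c` counted among the high letters.
      ≈⟨ ∷-cong c (swap-before b (lows a w) (highs a w) low high q) ⟩
    c ∷ highs a w ++ lows a w ++ b ∷ q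
      ≈⟨ swap-before b (lows a w) (c ∷ highs a w) low (b≤c ∷ high) q ⟨
    lows a w ++ c ∷ highs a w ++ b ∷ q ∎
    where
    low = lows-below a<b w
    high = highs-above w gap

  -- `L` and `H` accumulate the letters already sorted. A new low letter joins `L` by exchanging the
  -- blocks with pivot `a` before and after.
  separate-after : ∀ a L H → All (_≤ a) L → All (a <_) H → ∀ w →
                   (a ∷ L ++ H ++ w) ∼hypo (a ∷ (L ++ lows a w) ++ H ++ highs a w)
  separate-after a L H _ _ [] = ≡⇒∼ (cong (λ w → a ∷ w ++ H ++ []) (sym (++-identityʳ L)))
    where
    ≡⇒∼ : ∀ {u v : Word m} → u ≡ v → u ∼hypo v
    ≡⇒∼ refl = refl′
  separate-after a L H L≤a a<H (c ∷ w) with c ≤? a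
  ... | yes c≤a rewrite filter-accept (_≤? a) {c} {w} c≤a | filter-reject (a <?_) {c} {w} (ℕ.≤⇒≯ c≤a) = begin
    a ∷ L ++ H ++ c ∷ w            ≈⟨ swap-after a L H L≤a a<H (c ∷ w) ⟩
    a ∷ H ++ L ++ c ∷ w            ≡⟨ cong (λ v → a ∷ H ++ v) (++-assoc L [ c ] w) ⟨
    a ∷ H ++ (L ∷ʳ c) ++ w         ≈⟨ swap-after a (L ∷ʳ c) H Lc≤a a<H w ⟨
    a ∷ (L ∷ʳ c) ++ H ++ w         ≈⟨ separate-after a (L ∷ʳ c) H Lc≤a a<H w ⟩
    a ∷ ((L ∷ʳ c) ++ lows a w) ++ H ++ highs a w
      ≡⟨ cong (λ v → a ∷ v ++ H ++ highs a w) (++-assoc L [ c ] (lows a w)) ⟩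
    a ∷ (L ++ c ∷ lows a w) ++ H ++ highs a w ∎
    where
    Lc≤a = All.∷ʳ⁺ L≤a c≤a
  ... | no c≰a rewrite filter-reject (_≤? a) {c} {w} c≰a | filter-accept (a <?_) {c} {w} (ℕ.≰⇒> c≰a) = begin
    a ∷ L ++ H ++ c ∷ w            ≡⟨ cong (λ v → a ∷ L ++ v) (++-assoc H [ c ] w) ⟨
    a ∷ L ++ (H ∷ʳ c) ++ w
      ≈⟨ separate-after a L (H ∷ʳ c) L≤a (All.∷ʳ⁺ a<H (ℕ.≰⇒> c≰a)) w ⟩
    a ∷ (L ++ lows a w) ++ (H ∷ʳ c) ++ highs a w
      ≡⟨ cong (λ v → a ∷ (L ++ lows a w) ++ v) (++-assoc H [ c ] (highs a w)) ⟩
    a ∷ (L ++ lows a w) ++ H ++ c ∷ highs a w ∎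

  data Before (a b : Letter m) : Word m → Set where
    here  : ∀ {w} → b ∈ w → Before a b (a ∷ w)
    there : ∀ {c w} → Before a b w → Before a b (c ∷ w)

  ∈-split : ∀ {b} {w : Word m} → b ∈ w → ∃₂ λ s q → w ≡ s ++ b ∷ q
  ∈-split (here refl) = [] , _ , refl
  ∈-split (there {c} b∈w) with ∈-split b∈w
  ... | s , q , refl = c ∷ s , q , refl

  before-split : ∀ {a b w} → Before a b w → ∃₂ λ p s → ∃ λ q → w ≡ p ++ a ∷ s ++ b ∷ q
  before-split (here b∈w) with ∈-split b∈w
  ... | s , q , refl = [] , s , q , refl
  before-split (there {c} bef) with before-split bef
  ... | p , s , q , refl = c ∷ p , s , q , refl

  record Consecutive (a b : Letter m) (w : Word m) : Set where
    constructor consecutive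
    field
      a<b    : a < b
      gap    : Gap a b w
      before : Before a b w

  -- The chosen `b` sorts everything to its left. The chosen `a` is then in the low part and has
  -- only low letters between itself and the high part, so it sorts everything that follows.
  separate : ∀ {a b w} → Consecutive a b w → w ∼hypo (lows a w ++ highs a w)
  separate {a} {b} (consecutive a<b gap bef) with before-split bef
  ... | p , s , q , refl = begin
    p ++ a ∷ s ++ b ∷ q               ≡⟨ ++-assoc p (a ∷ s) (b ∷ q) ⟨
    P ++ b ∷ q                        ≈⟨ separate-before a<b P gapP q ⟩
    lows a P ++ highs a P ++ b ∷ q    ≡⟨ cong (λ w → w ++ highs a P ++ b ∷ q) lowsP ⟩
    (lows a p ++ a ∷ lows a s) ++ highs a P ++ b ∷ q
      ≡⟨ ++-assoc (lows a p) (a ∷ lows a s) (highs a P ++ b ∷ q) ⟩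
    lows a p ++ a ∷ lows a s ++ highs a P ++ b ∷ q
      ≡⟨ cong (λ w → lows a p ++ a ∷ lows a s ++ w) (++-assoc (highs a P) [ b ] q) ⟨
    lows a p ++ a ∷ lows a s ++ (highs a P ∷ʳ b) ++ q
      ≈⟨ ++-congʳ (lows a p) (separate-after a (lows a s) (highs a P ∷ʳ b)
           (All.all-filter (_≤? a) s) (All.∷ʳ⁺ (All.all-filter (a <?_) P) a<b) q) ⟩
    lows a p ++ (a ∷ lows a s ++ lows a q) ++ (highs a P ∷ʳ b) ++ highs a q
      ≡⟨ ++-assoc (lows a p) (a ∷ lows a s ++ lows a q) _ ⟨
    (lows a p ++ (a ∷ lows a s) ++ lows a q) ++ (highs a P ∷ʳ b) ++ highs a q
      ≡⟨ cong₂ _++_ (sym lows≡) (sym highs≡) ⟩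
    lows a (p ++ a ∷ s ++ b ∷ q) ++ highs a (p ++ a ∷ s ++ b ∷ q) ∎
    where
    P = p ++ a ∷ s
    gapP : Gap a b P
    gapP = All.++⁻ˡ P (subst (Gap a b) (sym (++-assoc p (a ∷ s) (b ∷ q))) gap)
    lowsP : lows a P ≡ lows a p ++ a ∷ lows a s
    lowsP = trans (filter-++ (_≤? a) p (a ∷ s))
      (cong (lows a p ++_) (filter-accept (_≤? a) {a} {s} ℕ.≤-refl))
    lows≡ : lows a (p ++ a ∷ s ++ b ∷ q) ≡ lows a p ++ (a ∷ lows a s) ++ lows a q
    lows≡ = trans (cong (lows a) (sym (++-assoc p (a ∷ s) (b ∷ q))))
      (trans (filter-++ (_≤? a) P (b ∷ q))
      (trans (cong₂ _++_ lowsP (filter-reject (_≤? a) {b} {q} (ℕ.<⇒≱ a<b)))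
      (++-assoc (lows a p) (a ∷ lows a s) (lows a q))))
    highs≡ : highs a (p ++ a ∷ s ++ b ∷ q) ≡ (highs a P ∷ʳ b) ++ highs a q
    highs≡ = trans (cong (highs a) (sym (++-assoc p (a ∷ s) (b ∷ q))))
      (trans (filter-++ (a <?_) P (b ∷ q))
      (trans (cong (highs a P ++_) (filter-accept (a <?_) {b} {q} a<b))
      (sym (++-assoc (highs a P) [ b ] (highs a q)))))

  -- Existence of consecutive pairs.

  before-∈ˡ : ∀ {a b w} → Before a b w → a ∈ w
  before-∈ˡ (here _)    = here refl
  before-∈ˡ (there bef) = there (before-∈ˡ bef)

  before-∈ʳ : ∀ {a b w} → Before a b w → b ∈ w
  before-∈ʳ (here b∈w)  = there b∈w
  before-∈ʳ (there bef) = there (before-∈ʳ bef)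

  -- For a fixed `a` to the left of a fixed `b`, any occurrence of `c` is that `a`, or lies to its
  -- right, or lies to the left of the `b`.
  before-insert : ∀ {a b c w} → Before a b w → c ∈ w → a ≡ c ⊎ Before a c w ⊎ Before c b w
  before-insert (here b∈w) (here refl) = inj₁ refl
  before-insert (here b∈w) (there c∈w) = inj₂ (inj₁ (here c∈w))
  before-insert (there bef) (here refl) = inj₂ (inj₂ (here (before-∈ʳ bef)))
  before-insert (there bef) (there c∈w) with before-insert bef c∈w
  ... | inj₁ a≡c        = inj₁ a≡c
  ... | inj₂ (inj₁ bef₁) = inj₂ (inj₁ (there bef₁))
  ... | inj₂ (inj₂ bef₂) = inj₂ (inj₂ (there bef₂))

  between-or-gap : ∀ a b (w : Word m) → (∃ λ c → c ∈ w × a < c × c < b) ⊎ Gap a b w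
  between-or-gap a b [] = inj₂ []
  between-or-gap a b (c ∷ w) with between-or-gap a b w
  ... | inj₁ (d , d∈w , p , q) = inj₁ (d , there d∈w , p , q)
  ... | inj₂ gap with c ≤? a | b ≤? c
  ...   | yes c≤a | _       = inj₂ (inj₁ c≤a ∷ gap)
  ...   | no _    | yes b≤c = inj₂ (inj₂ b≤c ∷ gap)
  ...   | no c≰a  | no b≰c  = inj₁ (c , here refl , ℕ.≰⇒> c≰a , ℕ.≰⇒> b≰c)

  -- A letter strictly between `a` and `b` forms with one of them an ascending pair of smaller
  -- difference; `k` bounds the difference.
  before⇒consecutive : ∀ k {a b w} → toℕ b ℕ.≤ k + toℕ a → a < b → Before a b w →
                       ∃₂ λ a b → Consecutive a b w
  before⇒consecutive zero b≤a a<b _ = contradiction b≤a (ℕ.<⇒≱ a<b)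
  before⇒consecutive (suc k) {a} {b} {w} b≤ a<b bef with between-or-gap a b w
  ... | inj₂ gap = a , b , consecutive a<b gap bef
  ... | inj₁ (c , c∈w , a<c , c<b) with before-insert bef c∈w
  ...   | inj₁ refl = contradiction a<c (ℕ.<-irrefl refl)
  ...   | inj₂ (inj₁ bef₁) = before⇒consecutive k (ℕ.≤-pred (ℕ.≤-trans c<b b≤)) a<c bef₁
  ...   | inj₂ (inj₂ bef₂) = before⇒consecutive k
    (ℕ.≤-trans b≤ (ℕ.≤-trans (ℕ.≤-reflexive (sym (ℕ.+-suc k _))) (ℕ.+-monoʳ-≤ k a<c))) c<b bef₂

  before-++ : ∀ p {a b w} → Before a b w → Before a b (p ++ w)
  before-++ []      bef = bef
  before-++ (_ ∷ p) bef = there (before-++ p bef)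

  consecutive-or-decreasing : ∀ (w : Word m) → (∃₂ λ a b → Consecutive a b w) ⊎ Decreasing w
  consecutive-or-decreasing w with ascent-or-decreasing w
  ... | inj₂ dec = inj₂ dec
  ... | inj₁ (ascent H₁ {x} {y} K₁ K₂ (x<y ∷ _) _) =
    inj₁ (before⇒consecutive (toℕ y) (ℕ.m≤m+n (toℕ y) (toℕ x)) x<y (before-++ H₁ (here (here refl))))

  decreasing-no-ascent : ∀ {a b w} → Decreasing w → a < b → ¬ Before a b w
  decreasing-no-ascent (a≥ ∷ _) a<b (here b∈w) = ℕ.<⇒≱ a<b (All.lookup a≥ b∈w)
  decreasing-no-ascent (_ ∷ dec) a<b (there bef) = decreasing-no-ascent dec a<b bef

  -- Content, and weakly decreasing words.

  count-there : ∀ {c d} (w : Word m) → ¬ c ≡ d → count c (d ∷ w) ≡ count c w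
  count-there {c} {d} w c≢d rewrite dec-false (c ≟ d) c≢d = refl

  ∈⇒count : ∀ {c} {w : Word m} → c ∈ w → ¬ count c w ≡ 0
  ∈⇒count {c} {d ∷ w} c∈ eq with c ≟ d
  ∈⇒count {c} {d ∷ w} (here c≡d)  eq | no c≢d = c≢d c≡d
  ∈⇒count {c} {d ∷ w} (there c∈w) eq | no _   = ∈⇒count c∈w eq

  count⇒∈ : ∀ {c} (w : Word m) → ¬ count c w ≡ 0 → c ∈ w
  count⇒∈ [] ≢0 = contradiction refl ≢0
  count⇒∈ {c} (d ∷ w) ≢0 with c ≟ d
  ... | yes c≡d = here c≡d
  ... | no _    = there (count⇒∈ w ≢0)

  count-cancel : ∀ {c d} (u v : Word m) → count c (d ∷ u) ≡ count c (d ∷ v) → count c u ≡ count c v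
  count-cancel {c} {d} u v eq with c ≟ d
  ... | yes _ = ℕ.suc-injective eq
  ... | no _  = eq

  SameContent : Word m → Word m → Set
  SameContent u v = ∀ c → count c u ≡ count c v

  content-∈ : ∀ {u v} → SameContent u v → ∀ {c} → c ∈ u → c ∈ v
  content-∈ {u} {v} same {c} c∈u = count⇒∈ v (λ eq → ∈⇒count c∈u (trans (same c) eq))

  decreasing-max : ∀ {x y : Letter m} {w} → Decreasing (x ∷ w) → y ∈ x ∷ w → y ≤ x
  decreasing-max _ (here refl) = ℕ.≤-refl
  decreasing-max (x≥ ∷ _) (there y∈w) = All.lookup x≥ y∈w

  -- The first letter is the maximum, which the content determines.
  decreasing-unique : ∀ {u v} → Decreasing u → Decreasing v → SameContent u v → u ≡ v
  decreasing-unique {[]} {[]} _ _ _ = refl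
  decreasing-unique {[]} {y ∷ v} _ _ same with () ← content-∈ {y ∷ v} {[]} (sym ∘ same) (here refl)
  decreasing-unique {x ∷ u} {[]} _ _ same with () ← content-∈ {x ∷ u} {[]} same (here refl)
  decreasing-unique {x ∷ u} {y ∷ v} du@(_ ∷ du′) dv@(_ ∷ dv′) same
    with toℕ-injective {i = x} {y} (ℕ.≤-antisym
           (decreasing-max dv (content-∈ {x ∷ u} {y ∷ v} same (here refl)))
           (decreasing-max du (content-∈ {y ∷ v} {x ∷ u} (sym ∘ same) (here refl))))
  ... | refl = cong (x ∷_) (decreasing-unique du′ dv′ (λ c → count-cancel u v (same c)))

  -- Restriction of the invariants to a set of letters, and their completeness for `∼hypo`.

  module _ {P : Pred (Letter m) 0ℓ} (P? : Decidable P) where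

    count-filter : ∀ {c} → P c → ∀ w → count c (filter P? w) ≡ count c w
    count-filter pc [] = refl
    count-filter {c} pc (d ∷ w) with P? d
    ... | no ¬pd = trans (count-filter pc w) (sym (count-there w (λ { refl → ¬pd pc })))
    ... | yes _ with c ≟ d
    ...   | yes _ = cong suc (count-filter pc w)
    ...   | no _  = count-filter pc w

    filter-content : ∀ {u v} → SameContent u v → SameContent (filter P? u) (filter P? v)
    filter-content {u} {v} same c with P? c
    ... | yes pc = trans (count-filter pc u) (trans (same c) (sym (count-filter pc v)))
    ... | no ¬pc = trans (absent u) (sym (absent v))
      where
      absent : ∀ w → count c (filter P? w) ≡ 0
      absent w with count c (filter P? w) ℕ.≟ 0
      ... | yes eq = eq
      ... | no ≢0  = contradiction (proj₂ (∈-filter⁻ P? {xs = w} (count⇒∈ _ ≢0))) ¬pc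

    before-filter⁺ : ∀ {a b w} → P a → P b → Before a b w → Before a b (filter P? w)
    before-filter⁺ {a} {b} {_ ∷ w} pa pb (here b∈w)
      rewrite filter-accept P? {a} {w} pa = here (∈-filter⁺ P? b∈w pb)
    before-filter⁺ {w = c ∷ _} pa pb (there bef) with P? c
    ... | yes _ = there (before-filter⁺ pa pb bef)
    ... | no _  = before-filter⁺ pa pb bef

    before-filter⁻ : ∀ {a b} w → Before a b (filter P? w) → Before a b w
    before-filter⁻ (c ∷ w) bef with P? c
    before-filter⁻ (c ∷ w) (here b∈)   | yes _ = here (proj₁ (∈-filter⁻ P? {xs = w} b∈))
    before-filter⁻ (c ∷ w) (there bef) | yes _ = there (before-filter⁻ w bef)
    before-filter⁻ (c ∷ w) bef         | no _  = there (before-filter⁻ w bef)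

    -- A letter removed by the filter is outside `P`, so by convexity it cannot lie between `a` and
    -- `b`.
    gap-filter⁻ : (∀ {a b c} → P a → P b → a ≤ c → c ≤ b → P c) →
                  ∀ {a b} → P a → P b → ∀ w → Gap a b (filter P? w) → Gap a b w
    gap-filter⁻ convex pa pb [] _ = []
    gap-filter⁻ convex {a} {b} pa pb (c ∷ w) gap with P? c
    gap-filter⁻ convex pa pb (c ∷ w) (g ∷ gap) | yes _ = g ∷ gap-filter⁻ convex pa pb w gap
    gap-filter⁻ convex {a} {b} pa pb (c ∷ w) gap | no ¬pc with c ≤? a | b ≤? c
    ... | yes c≤a | _       = inj₁ c≤a ∷ gap-filter⁻ convex pa pb w gap
    ... | no _    | yes b≤c = inj₂ b≤c ∷ gap-filter⁻ convex pa pb w gap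
    ... | no c≰a  | no b≰c  = contradiction (convex pa pb (ℕ.≰⇒≥ c≰a) (ℕ.≰⇒≥ b≰c)) ¬pc

    consecutive-filter : (∀ {a b c} → P a → P b → a ≤ c → c ≤ b → P c) →
      ∀ {u v} → (∀ {a b} → Consecutive a b u → Consecutive a b v) →
      ∀ {a b} → Consecutive a b (filter P? u) → Consecutive a b (filter P? v)
    consecutive-filter convex {u} {v} f {a} {b} (consecutive a<b gap bef)
      with f (consecutive a<b (gap-filter⁻ convex pa pb u gap) (before-filter⁻ u bef))
      where
      pa = proj₂ (∈-filter⁻ P? {xs = u} (before-∈ˡ bef))
      pb = proj₂ (∈-filter⁻ P? {xs = u} (before-∈ʳ bef))
    ... | consecutive _ gap′ bef′ = consecutive a<b (All.filter⁺ P? gap′) (before-filter⁺ pa pb bef′)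
      where
      pa = proj₂ (∈-filter⁻ P? {xs = u} (before-∈ˡ bef))
      pb = proj₂ (∈-filter⁻ P? {xs = u} (before-∈ʳ bef))

  invariants⇒∼-bounded : ∀ n {u v} → length u ℕ.≤ n → SameContent u v →
    (∀ {a b} → Consecutive a b u → Consecutive a b v) →
    (∀ {a b} → Consecutive a b v → Consecutive a b u) → u ∼hypo v
  invariants⇒∼-bounded n {u} {v} size same to from
    with consecutive-or-decreasing u | consecutive-or-decreasing v
  ... | inj₂ du | inj₂ dv rewrite decreasing-unique du dv same = refl′
  ... | inj₂ du | inj₁ (_ , _ , con) =
    let open Consecutive (from con) in contradiction before (decreasing-no-ascent du a<b)
  invariants⇒∼-bounded zero {[]} size same to from | inj₁ (_ , _ , consecutive _ _ ()) | _
  invariants⇒∼-bounded (suc n) {u} {v} size same to from | inj₁ (a , b , con) | _ = begin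
    u                     ≈⟨ separate con ⟩
    lows a u ++ highs a u
      ≈⟨ ++-congʳ (lows a u) (invariants⇒∼-bounded n (shorter high-size)
           (filter-content (a <?_) {u} {v} same)
           (consecutive-filter (a <?_) convex-high to) (consecutive-filter (a <?_) convex-high from)) ⟩
    lows a u ++ highs a v
      ≈⟨ ctx [] (highs a v) (invariants⇒∼-bounded n (shorter low-size)
           (filter-content (_≤? a) {u} {v} same)
           (consecutive-filter (_≤? a) convex-low to) (consecutive-filter (_≤? a) convex-low from)) ⟩
    lows a v ++ highs a v ≈⟨ separate (to con) ⟨
    v                     ∎
    where
    open Consecutive con
    shorter : ∀ {k} → k ℕ.< length u → k ℕ.≤ n
    shorter k< = ℕ.≤-pred (ℕ.≤-trans k< size)
    -- The low part lacks `b` and the high part lacks `a`.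
    low-size : length (lows a u) ℕ.< length u
    low-size = filter-notAll (_≤? a) u (lose (before-∈ʳ before) (ℕ.<⇒≱ a<b))
    high-size : length (highs a u) ℕ.< length u
    high-size = filter-notAll (a <?_) u (lose (before-∈ˡ before) (ℕ.<-irrefl refl))
    convex-low : ∀ {x y z : Letter m} → x ≤ a → y ≤ a → x ≤ z → z ≤ y → z ≤ a
    convex-low _ y≤a _ z≤y = ℕ.≤-trans z≤y y≤a
    convex-high : ∀ {x y z : Letter m} → a < x → a < y → x ≤ z → z ≤ y → a < z
    convex-high a<x _ x≤z _ = ℕ.<-≤-trans a<x x≤z

-- Inversions, and the invariance of consecutive pairs under quasi-crystal isomorphisms.

module _ {m : ℕ} where

  before-∷⁻ : ∀ {a b c : Letter m} {w} → Before a b (c ∷ w) → (a ≡ c × b ∈ w) ⊎ Before a b w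
  before-∷⁻ (here b∈w)  = inj₁ (refl , b∈w)
  before-∷⁻ (there bef) = inj₂ bef

  before-tail : ∀ {a b c : Letter m} {w} → ¬ a ≡ c → Before a b (c ∷ w) → Before a b w
  before-tail a≢c bef with before-∷⁻ bef
  ... | inj₁ (a≡c , _) = contradiction a≡c a≢c
  ... | inj₂ bef′      = bef′

  occurs⇒∈ : ∀ {c} (w : Word m) → occurs c w ≡ true → c ∈ w
  occurs⇒∈ {c} (d ∷ w) occ with c ≟ d
  ... | yes c≡d = here c≡d
  ... | no _    = there (occurs⇒∈ w occ)

  ∈⇒occurs : ∀ {c} {w : Word m} → c ∈ w → occurs c w ≡ true
  ∈⇒occurs {c} {d ∷ w} c∈ with c ≟ d
  ∈⇒occurs c∈          | yes _  = refl
  ∈⇒occurs (here c≡d)  | no c≢d = contradiction c≡d c≢d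
  ∈⇒occurs (there c∈w) | no _   = ∈⇒occurs c∈w

  Inverted : Fin m → Word m → Set
  Inverted i = Before (inject₁ i) (fsuc i)

  hasInv⇒inverted : ∀ i w → hasInv i w ≡ true → Inverted i w
  hasInv⇒inverted i (c ∷ w) inv with inject₁ i ≟ c
  ... | no _ = there (hasInv⇒inverted i w inv)
  ... | yes refl with occurs (fsuc i) w in occ
  ...   | true  = here (occurs⇒∈ w occ)
  ...   | false = there (hasInv⇒inverted i w inv)

  inverted⇒hasInv : ∀ i {w} → Inverted i w → hasInv i w ≡ true
  inverted⇒hasInv i (here {w} i+1∈w)
    rewrite dec-true (inject₁ i ≟ inject₁ i) refl | ∈⇒occurs i+1∈w = refl
  inverted⇒hasInv i (there {c} {w} inv) with inject₁ i ≟ c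
  ... | no _  = inverted⇒hasInv i inv
  ... | yes _ = trans (cong (occurs (fsuc i) w ∨_) (inverted⇒hasInv i inv)) (∨-zeroʳ _)

  not-inverted : ∀ i {w} → ¬ Inverted i w → hasInv i w ≡ false
  not-inverted i {w} ¬inv = ¬-not (¬inv ∘ hasInv⇒inverted i w)

  hasInv-cong : ∀ i {u v} → (Inverted i u → Inverted i v) → (Inverted i v → Inverted i u) →
                hasInv i u ≡ hasInv i v
  hasInv-cong i {u} {v} to from with hasInv i u in equ
  ... | true  = sym (inverted⇒hasInv i (to (hasInv⇒inverted i u equ)))
  ... | false with hasInv i v in eqv
  ...   | false = refl
  ...   | true with () ← trans (sym equ) (inverted⇒hasInv i (from (hasInv⇒inverted i v eqv)))

  ε̈-hasInv : ∀ i (u v : Word m) → ε̈ i u ≡ ε̈ i v → hasInv i u ≡ hasInv i v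
  ε̈-hasInv i u v eq with hasInv i u | hasInv i v
  ... | true  | true  = refl
  ... | false | false = refl

  inject₁≢suc : ∀ (i : Fin m) → ¬ inject₁ i ≡ fsuc i
  inject₁≢suc i eq = ℕ.1+n≢n (trans (sym (cong toℕ eq)) (toℕ-inject₁ i))

  raiseLetter : Fin m → Letter m → Letter m
  raiseLetter i c with inject₁ i ≟ c
  ... | yes _ = fsuc i
  ... | no _  = c

  raise : Fin m → Word m → Word m
  raise i = map (raiseLetter i)

  raiseLetter-hit : ∀ i → raiseLetter i (inject₁ i) ≡ fsuc i
  raiseLetter-hit i with inject₁ i ≟ inject₁ i
  ... | yes _  = refl
  ... | no i≢i = contradiction refl i≢i

  raiseLetter-miss : ∀ i {c} → ¬ inject₁ i ≡ c → raiseLetter i c ≡ c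
  raiseLetter-miss i {c} i≢c with inject₁ i ≟ c
  ... | yes i≡c = contradiction i≡c i≢c
  ... | no _    = refl

  raise-absent : ∀ i w → count (inject₁ i) w ≡ 0 → raise i w ≡ w
  raise-absent i [] _ = refl
  raise-absent i (c ∷ w) eq with inject₁ i ≟ c
  ... | no _ = cong (c ∷_) (raise-absent i w eq)

  -- Iterating f̈ᵢ from a word without i-inversion reaches the word raised at i.
  raise-step : ∀ i w {n} → count (inject₁ i) w ≡ suc n →
    ∃ λ w′ → replaceLeft (inject₁ i) (fsuc i) w ≡ just w′ × count (inject₁ i) w′ ≡ n ×
             raise i w′ ≡ raise i w × (Inverted i w′ → Inverted i w)
  raise-step i (c ∷ w) eq with inject₁ i ≟ c
  ... | yes refl = fsuc i ∷ w , refl ,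
    trans (count-there w (inject₁≢suc i)) (ℕ.suc-injective eq) ,
    cong (_∷ raise i w) (raiseLetter-miss i (inject₁≢suc i)) ,
    λ inv → there (before-tail (inject₁≢suc i) inv)
  ... | no i≢c with raise-step i w eq
  ...   | w′ , rep , cnt , rse , inv = c ∷ w′ , cong (Maybe.map (c ∷_)) rep ,
    trans (count-there w′ i≢c) cnt ,
    cong₂ _∷_ (raiseLetter-miss i i≢c) rse ,
    λ inv′ → there (inv (before-tail i≢c inv′))

  ∈-raise⁺ : ∀ i {b w} → ¬ inject₁ i ≡ b → b ∈ w → b ∈ raise i w
  ∈-raise⁺ i i≢b (here refl) = here (sym (raiseLetter-miss i i≢b))
  ∈-raise⁺ i i≢b (there b∈w) = there (∈-raise⁺ i i≢b b∈w)

  ∈-raise⁻ : ∀ i {b} w → ¬ fsuc i ≡ b → b ∈ raise i w → b ∈ w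
  ∈-raise⁻ i (c ∷ w) i+1≢b b∈ with inject₁ i ≟ c
  ∈-raise⁻ i (c ∷ w) i+1≢b (here b≡)  | yes _ = contradiction (sym b≡) i+1≢b
  ∈-raise⁻ i (c ∷ w) i+1≢b (here b≡)  | no _  = here b≡
  ∈-raise⁻ i (c ∷ w) i+1≢b (there b∈) | yes _ = there (∈-raise⁻ i w i+1≢b b∈)
  ∈-raise⁻ i (c ∷ w) i+1≢b (there b∈) | no _  = there (∈-raise⁻ i w i+1≢b b∈)

  before-raise⁺ : ∀ i {b w} → ¬ inject₁ i ≡ b → Before (inject₁ i) b w → Before (fsuc i) b (raise i w)
  before-raise⁺ i i≢b (here {w} b∈w) rewrite raiseLetter-hit i = here (∈-raise⁺ i i≢b b∈w)
  before-raise⁺ i i≢b (there bef) = there (before-raise⁺ i i≢b bef)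

  -- As `fsuc i` does not occur in `w`, each `fsuc i` of the raised word stems from an `inject₁ i`.
  before-raise⁻ : ∀ i {b} w → ¬ fsuc i ≡ b → ¬ fsuc i ∈ w →
                  Before (fsuc i) b (raise i w) → Before (inject₁ i) b w
  before-raise⁻ i (c ∷ w) ≢b ∉w bef with inject₁ i ≟ c
  ... | no _     = there (before-raise⁻ i w ≢b (∉w ∘ there) (before-tail (∉w ∘ here) bef))
  ... | yes refl with before-∷⁻ bef
  ...   | inj₁ (_ , b∈) = here (∈-raise⁻ i w ≢b b∈)
  ...   | inj₂ bef′     = there (before-raise⁻ i w ≢b (∉w ∘ there) bef′)

  gap-raise : ∀ i {b} → inject₁ i < b → ∀ {w} → Gap (inject₁ i) b w → Gap (fsuc i) b (raise i w)
  gap-raise i {b} i<b gap = All.map⁺ (All.map raised gap)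
    where
    raised : ∀ {c} → c ≤ inject₁ i ⊎ b ≤ c → raiseLetter i c ≤ fsuc i ⊎ b ≤ raiseLetter i c
    raised {c} p with inject₁ i ≟ c
    raised p              | yes _ = inj₁ ℕ.≤-refl
    raised (inj₂ b≤c)     | no _  = inj₂ b≤c
    raised (inj₁ c≤i)     | no _  = inj₁ (ℕ.≤-trans c≤i (ℕ.≤-trans (ℕ.≤-reflexive (toℕ-inject₁ i)) (ℕ.n≤1+n _)))

  gap-content : ∀ {a b} {u v : Word m} → SameContent v u → Gap a b u → Gap a b v
  gap-content {u = u} {v} same gap = All.tabulate (λ c∈v → All.lookup gap (content-∈ {u = v} {u} same c∈v))

  module _ {u v : Word m} {ψ : Word m → Word m} (iso : IsQCIso u v ψ) where
    open IsQCIso iso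

    -- Each `f̈ i` removes one `inject₁ i` and creates no `i`-inversion. Preservation of weight and
    -- `ε̈` makes `f̈ i` applicable to `ψ x` as often as to `x`.
    raise-component : ∀ i n x → InComp u x → count (inject₁ i) x ≡ n → ¬ Inverted i x →
                      InComp u (raise i x) × ψ (raise i x) ≡ raise i (ψ x)
    raise-component i zero x x∈ cnt _
      rewrite raise-absent i x cnt | raise-absent i (ψ x) (trans (wt-pres x x∈ (inject₁ i)) cnt) =
      x∈ , refl
    raise-component i (suc n) x x∈ cnt ¬inv
      with raise-step i x cnt | raise-step i (ψ x) (trans (wt-pres x x∈ (inject₁ i)) cnt)
    ... | x′ , rep , cnt′ , rse , inv | y′ , repψ , _ , rseψ , _ =
      subst (InComp u) rse (proj₁ rec) ,
      trans (cong ψ (sym rse)) (trans (proj₂ rec) (trans (cong (raise i) ψx′≡y′) rseψ))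
      where
      hasInv-x : hasInv i x ≡ false
      hasInv-x = not-inverted i ¬inv
      f̈x : f̈ i x ≡ just x′
      f̈x rewrite hasInv-x = rep
      f̈ψx : f̈ i (ψ x) ≡ just y′
      f̈ψx rewrite trans (ε̈-hasInv i (ψ x) x (ε-pres x x∈ i)) hasInv-x = repψ
      ψx′≡y′ : ψ x′ ≡ y′
      ψx′≡y′ = just-injective (trans (sym (trans (f-comm x x∈ i) (cong (Maybe.map ψ) f̈x))) f̈ψx)
      rec = raise-component i n x′ (x∈ ◅◅ (i , inj₂ f̈x) ◅ ε) cnt′ (¬inv ∘ inv)

    -- Induction on the number `k` of letters of the alphabet strictly between `a` and `b`. The word
    -- `x` ranges over the component, because each raising replaces it.
    before-iso : ∀ k {a b} x → InComp u x → toℕ b ≡ suc (k + toℕ a) → Gap a b x →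
                 (Before a b x → Before a b (ψ x)) × (Before a b (ψ x) → Before a b x)
    before-iso k {a} {b} x x∈ b≡ gap with index
      where
      a<m : toℕ a ℕ.< m
      a<m = ℕ.≤-trans (s≤s (ℕ.m≤n+m (toℕ a) k)) (ℕ.≤-trans (ℕ.≤-reflexive (sym b≡)) (ℕ.≤-pred (toℕ<n b)))
      index : ∃ λ i → inject₁ i ≡ a
      index = fromℕ< a<m , toℕ-injective (trans (toℕ-inject₁ _) (toℕ-fromℕ< a<m))
    before-iso zero {_} {b} x x∈ b≡ gap | i , refl
      with refl ← toℕ-injective {i = fsuc i} {b} (trans (cong suc (sym (toℕ-inject₁ i))) (sym b≡)) =
      (λ inv → hasInv⇒inverted i (ψ x) (trans same (inverted⇒hasInv i inv))) ,
      (λ inv → hasInv⇒inverted i x (trans (sym same) (inverted⇒hasInv i inv)))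
      where
      same : hasInv i (ψ x) ≡ hasInv i x
      same = ε̈-hasInv i (ψ x) x (ε-pres x x∈ i)
    before-iso (suc k) {_} {b} x x∈ b≡ gap | i , refl =
      (λ bef → before-raise⁻ i (ψ x) i+1≢b (i+1∉x ∘ content-∈ {u = ψ x} {x} (wt-pres x x∈))
                 (subst (Before (fsuc i) b) ψraise (proj₁ rec (before-raise⁺ i i≢b bef)))) ,
      (λ bef → before-raise⁻ i x i+1≢b i+1∉x
                 (proj₂ rec (subst (Before (fsuc i) b) (sym ψraise) (before-raise⁺ i i≢b bef))))
      where
      b≡′ : toℕ b ≡ suc (k + toℕ (fsuc i))
      b≡′ = trans b≡ (cong suc (trans (cong (suc k +_) (toℕ-inject₁ i)) (sym (ℕ.+-suc k (toℕ i)))))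
      i+1<b : fsuc i < b
      i+1<b = ℕ.≤-trans (s≤s (ℕ.m≤n+m _ k)) (ℕ.≤-reflexive (sym b≡′))
      i<i+1 : inject₁ i < fsuc i
      i<i+1 = s≤s (ℕ.≤-reflexive (toℕ-inject₁ i))
      i<b : inject₁ i < b
      i<b = ℕ.<-trans i<i+1 i+1<b
      i≢b : ¬ inject₁ i ≡ b
      i≢b refl = ℕ.<-irrefl refl i<b
      i+1≢b : ¬ fsuc i ≡ b
      i+1≢b refl = ℕ.<-irrefl refl i+1<b
      i+1∉x : ¬ fsuc i ∈ x
      i+1∉x i+1∈x with All.lookup gap i+1∈x
      ... | inj₁ i+1≤i = ℕ.<⇒≱ i<i+1 i+1≤i
      ... | inj₂ b≤i+1 = ℕ.<⇒≱ i+1<b b≤i+1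
      -- The gap excludes `fsuc i` from `x`, so `x` has no `i`-inversion.
      raised = raise-component i _ x x∈ refl (i+1∉x ∘ before-∈ʳ)
      ψraise = proj₂ raised
      rec = before-iso k (raise i x) (proj₁ raised) b≡′ (gap-raise i i<b gap)

    iso-content : SameContent u v
    iso-content c = trans (sym (wt-pres u ε c)) (cong (count c) base)

    private
      distance : ∀ {a b : Letter m} → a < b → toℕ b ≡ suc ((toℕ b ℕ.∸ suc (toℕ a)) + toℕ a)
      distance {a} {b} a<b = trans (sym (ℕ.m∸n+n≡m a<b)) (ℕ.+-suc (toℕ b ℕ.∸ suc (toℕ a)) (toℕ a))

    iso-consecutive⁺ : ∀ {a b} → Consecutive a b u → Consecutive a b v
    iso-consecutive⁺ {a} {b} (consecutive a<b gap bef) = consecutive a<b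
      (gap-content {u = u} {v} (sym ∘ iso-content) gap)
      (subst (Before a b) base (proj₁ (before-iso _ u ε (distance a<b) gap) bef))

    iso-consecutive⁻ : ∀ {a b} → Consecutive a b v → Consecutive a b u
    iso-consecutive⁻ {a} {b} (consecutive a<b gap bef) = consecutive a<b gapᵤ
      (proj₂ (before-iso _ u ε (distance a<b) gapᵤ) (subst (Before a b) (sym base) bef))
      where
      gapᵤ = gap-content {u = v} {u} iso-content gap

  iso⇒∼hypo : ∀ {u v : Word m} → u ∼̈ v → u ∼hypo v
  iso⇒∼hypo (_ , iso) = invariants⇒∼-bounded _ ℕ.≤-refl (iso-content iso)
    (iso-consecutive⁺ iso) (iso-consecutive⁻ iso)

  -- Invariance of the standardization along a component.

  -- Aligned words have the same standardization, for the convention that equal letters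
  -- are numbered from right to left.
  SameAscent : Letter m → Letter m → Letter m → Letter m → Set
  SameAscent c c′ d d′ = (c < d → c′ < d′) × (c′ < d′ → c < d)

  data Aligned : Word m → Word m → Set where
    []  : Aligned [] []
    _∷_ : ∀ {c c′ w w′} → Pointwise (SameAscent c c′) w w′ → Aligned w w′ →
          Aligned (c ∷ w) (c′ ∷ w′)

  aligned-refl : ∀ {w} → Aligned w w
  aligned-refl {[]}    = []
  aligned-refl {c ∷ w} = Pointwise.refl ((λ p → p) , (λ p → p)) ∷ aligned-refl

  aligned-sym : ∀ {u v} → Aligned u v → Aligned v u
  aligned-sym []       = []
  aligned-sym (r ∷ al) = Pointwise.symmetric (λ { (f , g) → g , f }) r ∷ aligned-sym al

  aligned-trans : ∀ {u v w} → Aligned u v → Aligned v w → Aligned u w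
  aligned-trans [] [] = []
  aligned-trans (r ∷ al) (s ∷ bl) =
    Pointwise.transitive (λ { (f , g) (h , k) → h ∘ f , g ∘ k }) r s ∷ aligned-trans al bl

  -- Replacing `inject₁ i` by `fsuc i` alters a comparison only with an `inject₁ i` to the left or a
  -- `fsuc i` to the right, and both are excluded.
  aligned-raise : ∀ i p {s} → ¬ inject₁ i ∈ p → ¬ fsuc i ∈ s →
                  Aligned (p ++ inject₁ i ∷ s) (p ++ fsuc i ∷ s)
  aligned-raise i [] {s} _ i+1∉s = ascents s i+1∉s ∷ aligned-refl
    where
    ascents : ∀ s → ¬ fsuc i ∈ s → Pointwise (SameAscent (inject₁ i) (fsuc i)) s s
    ascents [] _ = []
    ascents (d ∷ s) i+1∉ =
      ((λ i<d → Fin.≤∧≢⇒< (ℕ.≤-trans (ℕ.≤-reflexive (cong suc (sym (toℕ-inject₁ i)))) i<d) (i+1∉ ∘ here)) ,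
       (λ i+1<d → ℕ.≤-trans (s≤s (ℕ.≤-reflexive (toℕ-inject₁ i))) (ℕ.<⇒≤ i+1<d))) ∷
      ascents s (i+1∉ ∘ there)
  aligned-raise i (c ∷ p) {s} i∉p i+1∉s = ascents p ∷ aligned-raise i p (i∉p ∘ there) i+1∉s
    where
    c≢i : ¬ c ≡ inject₁ i
    c≢i c≡i = i∉p (here (sym c≡i))
    ascents : ∀ p → Pointwise (SameAscent c c) (p ++ inject₁ i ∷ s) (p ++ fsuc i ∷ s)
    ascents [] =
      ((λ c<i → ℕ.≤-trans c<i (ℕ.≤-trans (ℕ.≤-reflexive (toℕ-inject₁ i)) (ℕ.n≤1+n _))) ,
       (λ c<i+1 → Fin.≤∧≢⇒< (ℕ.≤-trans (ℕ.≤-pred c<i+1) (ℕ.≤-reflexive (sym (toℕ-inject₁ i)))) c≢i)) ∷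
      Pointwise.refl ((λ p → p) , (λ p → p))
    ascents (_ ∷ p) = ((λ p → p) , (λ p → p)) ∷ ascents p

  replaceLeft-split : ∀ {a b} (w : Word m) {w′} → replaceLeft a b w ≡ just w′ →
    ∃₂ λ p s → w ≡ p ++ a ∷ s × w′ ≡ p ++ b ∷ s × ¬ a ∈ p
  replaceLeft-split {a} {b} (c ∷ w) eq with a ≟ c
  replaceLeft-split (c ∷ w) refl | yes refl = [] , w , refl , refl , λ ()
  replaceLeft-split {a} {b} (c ∷ w) eq | no a≢c with replaceLeft a b w in rep
  replaceLeft-split (c ∷ w) refl | no a≢c | just w′ with replaceLeft-split w rep
  ... | p , s , refl , refl , a∉p =
    c ∷ p , s , refl , refl , λ { (here a≡c) → a≢c a≡c ; (there a∈p) → a∉p a∈p }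

  replaceRight-absent : ∀ {a b} (w : Word m) → replaceRight a b w ≡ nothing → ¬ a ∈ w
  replaceRight-absent {a} {b} (c ∷ w) eq a∈ with replaceRight a b w in rep
  ... | nothing with a ≟ c
  replaceRight-absent (c ∷ w) eq (here a≡c)  | nothing | no a≢c = a≢c a≡c
  replaceRight-absent (c ∷ w) eq (there a∈w) | nothing | no _   = replaceRight-absent w rep a∈w

  replaceRight-split : ∀ {a b} (w : Word m) {w′} → replaceRight a b w ≡ just w′ →
    ∃₂ λ p s → w ≡ p ++ a ∷ s × w′ ≡ p ++ b ∷ s × ¬ a ∈ s
  replaceRight-split {a} {b} (c ∷ w) eq with replaceRight a b w in rep
  replaceRight-split (c ∷ w) refl | just _ with replaceRight-split w rep
  ... | p , s , refl , refl , a∉s = c ∷ p , s , refl , refl , a∉s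
  replaceRight-split {a} (c ∷ w) eq | nothing with a ≟ c
  replaceRight-split (c ∷ w) refl | nothing | yes refl =
    [] , w , refl , refl , replaceRight-absent w rep

  before-∈++ : ∀ {a b : Letter m} {p s} → a ∈ p → Before a b (p ++ b ∷ s)
  before-∈++ {p = _ ∷ p} (here refl) = here (∈-++⁺ʳ p (here refl))
  before-∈++ (there a∈p) = there (before-∈++ a∈p)

  no-inversion : ∀ i {w : Word m} → hasInv i w ≡ false → ¬ Inverted i w
  no-inversion i hi inv with () ← trans (sym (inverted⇒hasInv i inv)) hi

  -- Choosing the right-most `fsuc i` or the left-most `inject₁ i` gives one premise of
  -- `aligned-raise`; the absence of an `i`-inversion gives the other.
  aligned-step : ∀ {w w′} → Step w w′ → Aligned w w′
  aligned-step {w} (i , inj₁ eq) with hasInv i w in hi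
  ... | false with replaceRight-split w eq
  ...   | p , s , refl , refl , i+1∉s =
    aligned-sym (aligned-raise i p (no-inversion i hi ∘ before-∈++) i+1∉s)
  aligned-step {w} (i , inj₂ eq) with hasInv i w in hi
  ... | false with replaceLeft-split w eq
  ...   | p , s , refl , refl , i∉p =
    aligned-raise i p i∉p (λ i+1∈s → no-inversion i hi (before-++ p (here i+1∈s)))

  aligned-component : ∀ {u x} → InComp u x → Aligned u x
  aligned-component ε         = aligned-refl
  aligned-component (st ◅ sts) = aligned-trans (aligned-step st) (aligned-component sts)

  -- Exchange of two adjacent positions.

  -- A word too short for the exchange is left alone, which makes the map an involution on all
  -- words.
  swapAt : ℕ → Word m → Word m
  swapAt zero    (c ∷ d ∷ w) = d ∷ c ∷ w
  swapAt (suc k) (c ∷ w)     = c ∷ swapAt k w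
  swapAt _       w           = w

  swapAt-involutive : ∀ k w → swapAt k (swapAt k w) ≡ w
  swapAt-involutive zero    []          = refl
  swapAt-involutive zero    (_ ∷ [])    = refl
  swapAt-involutive zero    (_ ∷ _ ∷ _) = refl
  swapAt-involutive (suc k) []          = refl
  swapAt-involutive (suc k) (c ∷ w)     = cong (c ∷_) (swapAt-involutive k w)

  swapAt-++ : ∀ p {c d q} → swapAt (length p) (p ++ c ∷ d ∷ q) ≡ p ++ d ∷ c ∷ q
  swapAt-++ []      = refl
  swapAt-++ (e ∷ p) = cong (e ∷_) (swapAt-++ p)

  count-swapAt : ∀ a k w → count a (swapAt k w) ≡ count a w
  count-swapAt a zero [] = refl
  count-swapAt a zero (_ ∷ []) = refl
  count-swapAt a zero (c ∷ d ∷ w) with a ≟ c in eqc | a ≟ d in eqd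
  ... | yes _ | yes _ rewrite eqc | eqd = refl
  ... | yes _ | no _  rewrite eqc | eqd = refl
  ... | no _  | yes _ rewrite eqc | eqd = refl
  ... | no _  | no _  rewrite eqc | eqd = refl
  count-swapAt a (suc k) [] = refl
  count-swapAt a (suc k) (c ∷ w) with a ≟ c
  ... | yes _ = cong suc (count-swapAt a k w)
  ... | no _  = count-swapAt a k w

  module _ {c d : Letter m} (c≢d : ¬ c ≡ d) (a b : Letter m) where

    -- The left-most `a` is carried along by the exchange unless both exchanged letters equal `a`,
    -- which `c≢d` rules out.
    replaceLeft-swapAt : ∀ p q → let w = p ++ c ∷ d ∷ q ; k = length p in
      replaceLeft a b (swapAt k w) ≡ Maybe.map (swapAt k) (replaceLeft a b w)
    replaceLeft-swapAt [] q with a ≟ c in eqc | a ≟ d in eqd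
    ... | yes refl | yes refl = contradiction refl c≢d
    ... | yes _    | no _  rewrite eqc = refl
    ... | no _     | yes _ rewrite eqd = refl
    ... | no _     | no _  rewrite eqc | eqd with replaceLeft a b q
    ...   | just _  = refl
    ...   | nothing = refl
    replaceLeft-swapAt (e ∷ p) q with a ≟ e
    ... | yes _ = refl
    ... | no _ rewrite replaceLeft-swapAt p q with replaceLeft a b (p ++ c ∷ d ∷ q)
    ...   | just _  = refl
    ...   | nothing = refl

    replaceRight-swapAt : ∀ p q → let w = p ++ c ∷ d ∷ q ; k = length p in
      replaceRight a b (swapAt k w) ≡ Maybe.map (swapAt k) (replaceRight a b w)
    replaceRight-swapAt [] q with replaceRight a b q
    ... | just _  = refl
    ... | nothing with a ≟ c in eqc | a ≟ d in eqd
    ...   | yes refl | yes refl = contradiction refl c≢d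
    ...   | yes _    | no _  rewrite eqc = refl
    ...   | no _     | yes _ rewrite eqd = refl
    ...   | no _     | no _  rewrite eqc | eqd = refl
    replaceRight-swapAt (e ∷ p) q rewrite replaceRight-swapAt p q
      with replaceRight a b (p ++ c ∷ d ∷ q)
    ... | just _  = refl
    ... | nothing with a ≟ e
    ...   | yes _ = refl
    ...   | no _  = refl

  -- Only the exchanged pair changes its order, so an inversion can be lost only if this pair forms
  -- it.
  inverted-swap : ∀ i (p : Word m) {c d q} → Inverted i (p ++ c ∷ d ∷ q) →
                  Inverted i (p ++ d ∷ c ∷ q) ⊎ (c ≡ inject₁ i × d ≡ fsuc i)
  inverted-swap i [] inv with before-∷⁻ inv
  ... | inj₁ (i≡c , here i+1≡d) = inj₂ (sym i≡c , sym i+1≡d)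
  ... | inj₁ (refl , there i+1∈q) = inj₁ (there (here i+1∈q))
  ... | inj₂ inv′ with before-∷⁻ inv′
  ...   | inj₁ (refl , i+1∈q) = inj₁ (here (there i+1∈q))
  ...   | inj₂ inv″ = inj₁ (there (there inv″))
  inverted-swap i (e ∷ p) {c} {d} {q} inv with before-∷⁻ inv
  ... | inj₁ (refl , i+1∈) = inj₁ (here (swap-∈ p i+1∈))
    where
    swap-∈ : ∀ p {x} → x ∈ p ++ c ∷ d ∷ q → x ∈ p ++ d ∷ c ∷ q
    swap-∈ []      (here x≡c)          = there (here x≡c)
    swap-∈ []      (there (here x≡d))  = here x≡d
    swap-∈ []      (there (there x∈q)) = there (there x∈q)
    swap-∈ (_ ∷ p) (here x≡e)          = here x≡e
    swap-∈ (_ ∷ p) (there x∈)          = there (swap-∈ p x∈)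
  ... | inj₂ inv′ with inverted-swap i p inv′
  ...   | inj₁ inv″ = inj₁ (there inv″)
  ...   | inj₂ eqs  = inj₂ eqs

  -- Maps compatible with the quasi-crystal structure.

  -- The replacements appear without the test for inversions, since the exchange of unequal letters
  -- commutes with them in any case; `inv` accounts for the test.
  record Agree (ψ : Word m → Word m) (x : Word m) : Set where
    field
      content : ∀ a → count a (ψ x) ≡ count a x
      inv     : ∀ i → hasInv i (ψ x) ≡ hasInv i x
      right   : ∀ i → replaceRight (fsuc i) (inject₁ i) (ψ x) ≡
                      Maybe.map ψ (replaceRight (fsuc i) (inject₁ i) x)
      left    : ∀ i → replaceLeft (inject₁ i) (fsuc i) (ψ x) ≡
                      Maybe.map ψ (replaceLeft (inject₁ i) (fsuc i) x)

  -- The second premise concerns a pair with letters `inject₁ i` and `fsuc i`: in ascending order it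
  -- is itself an `i`-inversion, so the word with the descending order must contain another one.
  agree-swapAt : ∀ (p : Word m) {c d q} → d < c →
    (∀ i → d ≡ inject₁ i → c ≡ fsuc i → Inverted i (p ++ c ∷ d ∷ q)) →
    Agree (swapAt (length p)) (p ++ c ∷ d ∷ q) × Agree (swapAt (length p)) (p ++ d ∷ c ∷ q)
  agree-swapAt p {c} {d} {q} d<c gate =
    record
      { content = λ a → count-swapAt a (length p) _
      ; inv     = λ i → trans (cong (hasInv i) (swapAt-++ p)) (sym (same i))
      ; right   = λ i → replaceRight-swapAt (c≢d) _ _ p q
      ; left    = λ i → replaceLeft-swapAt (c≢d) _ _ p q } ,
    record
      { content = λ a → count-swapAt a (length p) _
      ; inv     = λ i → trans (cong (hasInv i) (swapAt-++ p)) (same i)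
      ; right   = λ i → replaceRight-swapAt (c≢d ∘ sym) _ _ p q
      ; left    = λ i → replaceLeft-swapAt (c≢d ∘ sym) _ _ p q }
    where
    c≢d : ¬ c ≡ d
    c≢d refl = ℕ.<-irrefl refl d<c
    same : ∀ i → hasInv i (p ++ c ∷ d ∷ q) ≡ hasInv i (p ++ d ∷ c ∷ q)
    same i = hasInv-cong i to from
      where
      to : Inverted i (p ++ c ∷ d ∷ q) → Inverted i (p ++ d ∷ c ∷ q)
      to inv with inverted-swap i p inv
      ... | inj₁ inv′ = inv′
      ... | inj₂ (refl , refl) =
        contradiction d<c (ℕ.<⇒≯ (s≤s (ℕ.≤-reflexive (toℕ-inject₁ i))))
      from : Inverted i (p ++ d ∷ c ∷ q) → Inverted i (p ++ c ∷ d ∷ q)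
      from inv with inverted-swap i p inv
      ... | inj₁ inv′ = inv′
      ... | inj₂ (d≡ , c≡) = gate i d≡ c≡

  module _ {ψ : Word m → Word m} where

    agree-ε̈ : ∀ {x} → Agree ψ x → ∀ i → ε̈ i (ψ x) ≡ ε̈ i x
    agree-ε̈ ag i rewrite Agree.inv ag i | Agree.content ag (fsuc i) = refl

    agree-φ̈ : ∀ {x} → Agree ψ x → ∀ i → φ̈ i (ψ x) ≡ φ̈ i x
    agree-φ̈ ag i rewrite Agree.inv ag i | Agree.content ag (inject₁ i) = refl

    agree-ë : ∀ {x} → Agree ψ x → ∀ i → ë i (ψ x) ≡ Maybe.map ψ (ë i x)
    agree-ë {x} ag i rewrite Agree.inv ag i with hasInv i x
    ... | true  = refl
    ... | false = Agree.right ag i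

    agree-f̈ : ∀ {x} → Agree ψ x → ∀ i → f̈ i (ψ x) ≡ Maybe.map ψ (f̈ i x)
    agree-f̈ {x} ag i rewrite Agree.inv ag i with hasInv i x
    ... | true  = refl
    ... | false = Agree.left ag i

    step-image : ∀ {x y} → Agree ψ x → Step x y → Step (ψ x) (ψ y)
    step-image ag (i , inj₁ eq) = i , inj₁ (trans (agree-ë ag i) (cong (Maybe.map ψ) eq))
    step-image ag (i , inj₂ eq) = i , inj₂ (trans (agree-f̈ ag i) (cong (Maybe.map ψ) eq))

    map-just⁻ : ∀ (mx : Maybe (Word m)) {y} → Maybe.map ψ mx ≡ just y → ∃ λ x → mx ≡ just x × ψ x ≡ y
    map-just⁻ (just x) refl = x , refl , refl

    step-preimage : ∀ {x y} → Agree ψ x → Step (ψ x) y → ∃ λ x′ → Step x x′ × ψ x′ ≡ y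
    step-preimage {x} ag (i , inj₁ eq) with map-just⁻ (ë i x) (trans (sym (agree-ë ag i)) eq)
    ... | x′ , ëx , ψx′ = x′ , (i , inj₁ ëx) , ψx′
    step-preimage {x} ag (i , inj₂ eq) with map-just⁻ (f̈ i x) (trans (sym (agree-f̈ ag i)) eq)
    ... | x′ , f̈x , ψx′ = x′ , (i , inj₂ f̈x) , ψx′

    component-image : ∀ {u x} → (∀ {x} → InComp u x → Agree ψ x) → InComp u x → InComp (ψ u) (ψ x)
    component-image ag ε          = ε
    component-image ag (st ◅ sts) =
      step-image (ag ε) st ◅ component-image (λ x∈ → ag (st ◅ x∈)) sts

    component-preimage : ∀ {u y} → (∀ {x} → InComp u x → Agree ψ x) → InComp (ψ u) y →
                         ∃ λ x → InComp u x × ψ x ≡ y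
    component-preimage ag ε = _ , ε , refl
    component-preimage ag (st ◅ sts) with step-preimage (ag ε) st
    ... | _ , st′ , refl with component-preimage (λ x∈ → ag (st′ ◅ x∈)) sts
    ...   | x , x∈ , ψx = x , st′ ◅ x∈ , ψx

  -- Isomorphisms with a global inverse.

  -- An isomorphism between components whose underlying map is a bijection on all words:
  -- the global inverse is what makes this relation evidently symmetric.
  record GlobalIso (u v : Word m) : Set where
    field
      ψ φ : Word m → Word m
      φψ  : ∀ w → φ (ψ w) ≡ w
      ψφ  : ∀ w → ψ (φ w) ≡ w
      iso : IsQCIso u v ψ

  globalIso : ∀ {u} ψ → (∀ w → ψ (ψ w) ≡ w) → (∀ {x} → InComp u x → Agree ψ x) → GlobalIso u (ψ u)
  globalIso {u} ψ ψψ ag = record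
    { ψ = ψ ; φ = ψ ; φψ = ψψ ; ψφ = ψψ
    ; iso = record
      { maps-to    = λ _ → component-image ag
      ; injective  = λ x y _ _ eq → trans (sym (ψψ x)) (trans (cong ψ eq) (ψψ y))
      ; surjective = λ _ → component-preimage ag
      ; base       = refl
      ; wt-pres    = λ _ x∈ → Agree.content (ag x∈)
      ; ε-pres     = λ _ x∈ → agree-ε̈ (ag x∈)
      ; φ-pres     = λ _ x∈ → agree-φ̈ (ag x∈)
      ; e-comm     = λ _ x∈ → agree-ë (ag x∈)
      ; f-comm     = λ _ x∈ → agree-f̈ (ag x∈) } }

  globalIso-refl : ∀ {u} → GlobalIso u u
  globalIso-refl = globalIso (λ w → w) (λ _ → refl) (λ _ → record
    { content = λ _ → refl ; inv = λ _ → refl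
    ; right = λ _ → sym (Maybe.map-id _) ; left = λ _ → sym (Maybe.map-id _) })

  globalIso-sym : ∀ {u v} → GlobalIso u v → GlobalIso v u
  globalIso-sym {u} {v} g = record
    { ψ = φ ; φ = ψ ; φψ = ψφ ; ψφ = φψ
    ; iso = record
      { maps-to    = λ y y∈ → proj₁ (back y y∈)
      ; injective  = λ x y _ _ eq → trans (sym (ψφ x)) (trans (cong ψ eq) (ψφ y))
      ; surjective = λ x x∈ → ψ x , I.maps-to x x∈ , φψ x
      ; base       = trans (cong φ (sym I.base)) (φψ u)
      ; wt-pres    = λ y y∈ a → transport y y∈ (λ w → count a w) (λ x x∈ → I.wt-pres x x∈ a)
      ; ε-pres     = λ y y∈ i → transport y y∈ (ε̈ i) (λ x x∈ → I.ε-pres x x∈ i)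
      ; φ-pres     = λ y y∈ i → transport y y∈ (φ̈ i) (λ x x∈ → I.φ-pres x x∈ i)
      ; e-comm     = λ y y∈ i → conjugate y y∈ (ë i) (λ x x∈ → I.e-comm x x∈ i)
      ; f-comm     = λ y y∈ i → conjugate y y∈ (f̈ i) (λ x x∈ → I.f-comm x x∈ i) } }
    where
    open GlobalIso g
    module I = IsQCIso iso
    back : ∀ y → InComp v y → InComp u (φ y) × ψ (φ y) ≡ y
    back y y∈ with I.surjective y y∈
    ... | x , x∈ , refl = subst (InComp u) (sym (φψ x)) x∈ , ψφ (ψ x)
    transport : ∀ {A : Set} y → InComp v y → (f : Word m → A) →
                (∀ x → InComp u x → f (ψ x) ≡ f x) → f (φ y) ≡ f y
    transport y y∈ f eq = trans (sym (eq (φ y) (proj₁ (back y y∈)))) (cong f (ψφ y))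
    conjugate : ∀ y → InComp v y → (f : Word m → Maybe (Word m)) →
                (∀ x → InComp u x → f (ψ x) ≡ Maybe.map ψ (f x)) → f (φ y) ≡ Maybe.map φ (f y)
    conjugate y y∈ f eq = begin
      f (φ y)                               ≡⟨ Maybe.map-id (f (φ y)) ⟨
      Maybe.map (λ w → w) (f (φ y))         ≡⟨ Maybe.map-cong φψ (f (φ y)) ⟨
      Maybe.map (φ ∘ ψ) (f (φ y))           ≡⟨ Maybe.map-∘ (f (φ y)) ⟩
      Maybe.map φ (Maybe.map ψ (f (φ y)))   ≡⟨ cong (Maybe.map φ) (eq (φ y) (proj₁ (back y y∈))) ⟨
      Maybe.map φ (f (ψ (φ y)))             ≡⟨ cong (Maybe.map φ ∘ f) (ψφ y) ⟩
      Maybe.map φ (f y)                     ∎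
      where open ≡-Reasoning

  globalIso-trans : ∀ {u v w} → GlobalIso u v → GlobalIso v w → GlobalIso u w
  globalIso-trans {u} {v} {w} g h = record
    { ψ = H.ψ ∘ G.ψ ; φ = G.φ ∘ H.φ
    ; φψ = λ x → trans (cong G.φ (H.φψ (G.ψ x))) (G.φψ x)
    ; ψφ = λ x → trans (cong H.ψ (G.ψφ (H.φ x))) (H.ψφ x)
    ; iso = record
      { maps-to    = λ x x∈ → J.maps-to _ (I.maps-to x x∈)
      ; injective  = λ x y x∈ y∈ eq →
          I.injective x y x∈ y∈ (J.injective _ _ (I.maps-to x x∈) (I.maps-to y y∈) eq)
      ; surjective = surj
      ; base       = trans (cong H.ψ I.base) J.base
      ; wt-pres    = λ x x∈ a → trans (J.wt-pres _ (I.maps-to x x∈) a) (I.wt-pres x x∈ a)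
      ; ε-pres     = λ x x∈ i → trans (J.ε-pres _ (I.maps-to x x∈) i) (I.ε-pres x x∈ i)
      ; φ-pres     = λ x x∈ i → trans (J.φ-pres _ (I.maps-to x x∈) i) (I.φ-pres x x∈ i)
      ; e-comm     = λ x x∈ i → compose (ë i x) (J.e-comm _ (I.maps-to x x∈) i) (I.e-comm x x∈ i)
      ; f-comm     = λ x x∈ i → compose (f̈ i x) (J.f-comm _ (I.maps-to x x∈) i) (I.f-comm x x∈ i) } }
    where
    module G = GlobalIso g
    module H = GlobalIso h
    module I = IsQCIso G.iso
    module J = IsQCIso H.iso
    surj : ∀ z → InComp w z → ∃ λ x → InComp u x × H.ψ (G.ψ x) ≡ z
    surj z z∈ with J.surjective z z∈
    ... | y , y∈ , refl with I.surjective y y∈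
    ...   | x , x∈ , refl = x , x∈ , refl
    compose : ∀ {p q} (r : Maybe (Word m)) → p ≡ Maybe.map H.ψ q → q ≡ Maybe.map G.ψ r →
              p ≡ Maybe.map (H.ψ ∘ G.ψ) r
    compose r refl refl = sym (Maybe.map-∘ r)

  -- Exchanges licensed by a third letter, and the defining relations.

  -- The conditions of `knuth-left` and `knuth-right`, with the third letter at any distance from
  -- the pair.
  LeftGate RightGate : Letter m → Letter m → Word m → Set
  LeftGate x z  = Any (λ y → x ≤ y × y < z)
  RightGate x z = Any (λ y → x < y × y ≤ z)

  left-gate-< : ∀ {x z p} → LeftGate x z p → x < z
  left-gate-< (here (x≤y , y<z)) = ℕ.≤-<-trans x≤y y<z
  left-gate-< (there gate)       = left-gate-< gate

  right-gate-< : ∀ {x z q} → RightGate x z q → x < z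
  right-gate-< (here (x<y , y≤z)) = ℕ.<-≤-trans x<y y≤z
  right-gate-< (there gate)       = right-gate-< gate

  -- If `x` and `z` are `inject₁ i` and `fsuc i`, the gate letter must be `inject₁ i`, which
  -- precedes `z` in either order of the pair.
  agree-left-gate : ∀ p {x z q} → LeftGate x z p → Agree (swapAt (length p)) (p ++ z ∷ x ∷ q)
  agree-left-gate p gate = proj₁ (agree-swapAt p (left-gate-< gate) (inverted gate))
    where
    inverted : ∀ {p x z q} → LeftGate x z p → ∀ i → x ≡ inject₁ i → z ≡ fsuc i → Inverted i (p ++ z ∷ x ∷ q)
    inverted {_ ∷ p} (here (x≤y , y<z)) i refl refl
      with refl ← toℕ-injective (ℕ.≤-antisym (ℕ.≤-trans (ℕ.≤-pred y<z) (ℕ.≤-reflexive (sym (toℕ-inject₁ i)))) x≤y) =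
      here (∈-++⁺ʳ p (here refl))
    inverted (there gate) i x≡ z≡ = there (inverted gate i x≡ z≡)

  agree-right-gate : ∀ p {x z q} → RightGate x z q → Agree (swapAt (length p)) (p ++ x ∷ z ∷ q)
  agree-right-gate p {x} {z} gate = proj₂ (agree-swapAt p (right-gate-< gate) inverted)
    where
    occurs-right : ∀ {i q} → RightGate (inject₁ i) (fsuc i) q → fsuc i ∈ q
    occurs-right {i} (here (i<y , y≤i+1)) = here (toℕ-injective (ℕ.≤-antisym
      (ℕ.≤-trans (s≤s (ℕ.≤-reflexive (sym (toℕ-inject₁ i)))) i<y) y≤i+1))
    occurs-right (there gate) = there (occurs-right gate)
    inverted : ∀ i → x ≡ inject₁ i → z ≡ fsuc i → Inverted i (p ++ z ∷ x ∷ _)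
    inverted i refl refl = before-++ p (there (here (occurs-right gate)))

  pointwise-drop : ∀ {c c′} p {q w′} → Pointwise (SameAscent c c′) (p ++ q) w′ →
    ∀ {p′ q′} → length p ≡ length p′ → w′ ≡ p′ ++ q′ → Pointwise (SameAscent c c′) q q′
  pointwise-drop []      rs {[]}     _   refl = rs
  pointwise-drop (_ ∷ p) (_ ∷ rs) {_ ∷ p′} len refl = pointwise-drop p rs (ℕ.suc-injective len) refl

  -- As `y` stands to the left of `z` and `x`, the condition `x ≤ y < z` says that `y`, `z` ascend
  -- and `y`, `x` do not. Hence every aligned word has a gate at the same position.
  aligned-agree-left : ∀ p {x z q w′} → LeftGate x z p → Aligned (p ++ z ∷ x ∷ q) w′ →
                       Agree (swapAt (length p)) w′
  aligned-agree-left p {x} {z} {q} gate al with split p al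
    where
    split : ∀ p {w′} → Aligned (p ++ z ∷ x ∷ q) w′ →
            ∃₂ λ p′ z′ → ∃₂ λ x′ q′ → length p ≡ length p′ × w′ ≡ p′ ++ z′ ∷ x′ ∷ q′ ×
            (LeftGate x z p → LeftGate x′ z′ p′)
    split [] (_ ∷ _ ∷ _) = [] , _ , _ , _ , refl , refl , λ ()
    split (y ∷ p) (_∷_ {c′ = y′} r al) with split p al
    ... | p′ , z′ , x′ , q′ , len , refl , gate′ =
      y′ ∷ p′ , z′ , x′ , q′ , cong suc len , refl , λ
        { (here (x≤y , y<z)) → here (moved x≤y y<z (pointwise-drop p r len refl))
        ; (there gate) → there (gate′ gate) }
      where
      moved : x ≤ y → y < z → Pointwise (SameAscent y y′) (z ∷ x ∷ q) (z′ ∷ x′ ∷ q′) →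
              x′ ≤ y′ × y′ < z′
      moved x≤y y<z ((f , _) ∷ (_ , g) ∷ _) = ℕ.≮⇒≥ (λ y′<x′ → ℕ.<⇒≱ (g y′<x′) x≤y) , f y<z
  ... | p′ , z′ , x′ , q′ , len , refl , gate′ rewrite len = agree-left-gate p′ (gate′ gate)

  aligned-agree-right : ∀ p {x z q w′} → RightGate x z q → Aligned (p ++ x ∷ z ∷ q) w′ →
                        Agree (swapAt (length p)) w′
  aligned-agree-right p {x} {z} {q} gate al with split p al
    where
    moved : ∀ {x′ z′ q q′} → Pointwise (SameAscent x x′) q q′ → Pointwise (SameAscent z z′) q q′ →
            RightGate x z q → RightGate x′ z′ q′
    moved ((f , _) ∷ _) ((_ , g) ∷ _) (here (x<y , y≤z)) =
      here (f x<y , ℕ.≮⇒≥ (λ z′<y′ → ℕ.<⇒≱ (g z′<y′) y≤z))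
    moved (_ ∷ r) (_ ∷ s) (there gate) = there (moved r s gate)
    split : ∀ p {w′} → Aligned (p ++ x ∷ z ∷ q) w′ →
            ∃₂ λ p′ x′ → ∃₂ λ z′ q′ → length p ≡ length p′ × w′ ≡ p′ ++ x′ ∷ z′ ∷ q′ ×
            RightGate x′ z′ q′
    split [] ((_ ∷ r) ∷ s ∷ _) = [] , _ , _ , _ , refl , refl , moved r s gate
    split (_ ∷ p) (_∷_ {c′ = y′} _ al) with split p al
    ... | p′ , x′ , z′ , q′ , len , refl , gate′ =
      y′ ∷ p′ , x′ , z′ , q′ , cong suc len , refl , gate′
  ... | p′ , x′ , z′ , q′ , len , refl , gate′ rewrite len = agree-right-gate p′ gate′

  swap-left-gate : ∀ p {x z q} → LeftGate x z p → GlobalIso (p ++ z ∷ x ∷ q) (p ++ x ∷ z ∷ q)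
  swap-left-gate p gate = subst (GlobalIso _) (swapAt-++ p)
    (globalIso (swapAt (length p)) (swapAt-involutive (length p))
      (aligned-agree-left p gate ∘ aligned-component))

  swap-right-gate : ∀ p {x z q} → RightGate x z q → GlobalIso (p ++ x ∷ z ∷ q) (p ++ z ∷ x ∷ q)
  swap-right-gate p gate = subst (GlobalIso _) (swapAt-++ p)
    (globalIso (swapAt (length p)) (swapAt-involutive (length p))
      (aligned-agree-right p gate ∘ aligned-component))

  swap-left-gate-at : ∀ p s {x z q} → LeftGate x z s → GlobalIso (p ++ s ++ z ∷ x ∷ q) (p ++ s ++ x ∷ z ∷ q)
  swap-left-gate-at p s gate = subst₂ GlobalIso (++-assoc p s _) (++-assoc p s _)
    (swap-left-gate (p ++ s) (Any.++⁺ʳ p gate))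

  gen-iso : ∀ {u v} p q → HypoGen u v → GlobalIso (p ++ u ++ q) (p ++ v ++ q)
  gen-iso p q (knuth₁ {y = y} x<y y<z) = swap-left-gate-at p [ y ] (here (ℕ.<⇒≤ x<y , y<z))
  gen-iso p q (knuth₂ x<y y<z) = swap-right-gate p (here (x<y , ℕ.<⇒≤ y<z))
  gen-iso p q (knuth₃ {x} x<y) = swap-left-gate-at p [ x ] (here (ℕ.≤-refl , x<y))
  gen-iso p q (knuth₄ x<y) = swap-right-gate p (here (x<y , ℕ.≤-refl))
  -- Both sides are one exchange away from `z x t y`, with gates `y` and `x`.
  gen-iso p q (quartic₁ {x = x} {z = z} t≤x x<y y≤z) = globalIso-trans
    (swap-right-gate p (there (here (x<y , y≤z))))
    (globalIso-sym (swap-left-gate-at p (z ∷ x ∷ []) (there (here (t≤x , x<y)))))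
  -- Both sides are one exchange away from `y t x z`, with gates `y` and `x`.
  gen-iso p q (quartic₂ {t} {y = y} t<x x≤y y<z) = globalIso-trans
    (swap-left-gate-at p (y ∷ t ∷ []) (here (x≤y , y<z)))
    (globalIso-sym (swap-right-gate p (here (t<x , x≤y))))

  -- The context belongs to the statement, so that the case `ctx` merely enlarges it.
  ∼hypo⇒globalIso : ∀ {u v} p q → u ∼hypo v → GlobalIso (p ++ u ++ q) (p ++ v ++ q)
  ∼hypo⇒globalIso p q (gen g) = gen-iso p q g
  ∼hypo⇒globalIso p q (ctx {u} {v} p′ q′ r) =
    subst₂ GlobalIso (assoc u) (assoc v) (∼hypo⇒globalIso (p ++ p′) (q′ ++ q) r)
    where
    assoc : ∀ w → (p ++ p′) ++ w ++ q′ ++ q ≡ p ++ (p′ ++ w ++ q′) ++ q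
    assoc w = trans (++-assoc p p′ _) (cong (p ++_)
      (sym (trans (++-assoc p′ (w ++ q′) q) (cong (p′ ++_) (++-assoc w q′ q)))))
  ∼hypo⇒globalIso p q refl′ = globalIso-refl
  ∼hypo⇒globalIso p q (sym′ r) = globalIso-sym (∼hypo⇒globalIso p q r)
  ∼hypo⇒globalIso p q (trans′ r s) = globalIso-trans (∼hypo⇒globalIso p q r) (∼hypo⇒globalIso p q s)

  ∼hypo⇒iso : ∀ {u v : Word m} → u ∼hypo v → u ∼̈ v
  ∼hypo⇒iso {u} {v} r with ∼hypo⇒globalIso [] [] r
  ... | g rewrite ++-identityʳ u | ++-identityʳ v = GlobalIso.ψ g , GlobalIso.iso g

theorem8p6 : (m : ℕ) → 1 ℕ.≤ m → (u v : Word m) → (u ∼̈ v) ⇔ (u ∼hypo v)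
theorem8p6 m _ u v = mk⇔ iso⇒∼hypo ∼hypo⇒iso
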